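{- Let $n = 2^k$ with $k \geq 1$ an integer, let $FT(n)$ be the $n \times n$ Discrete Fourier Transform matrix, and let $r \leq n/2$ be a power of $2$. Then $$R_{FT(n)}(r) \geq \frac{n^2}{4r}.$$
   Context: Matrices are over the complex numbers. For a matrix $A$, $\operatorname{weight}(A)$ denotes the number of non-zero entries of $A$. The rigidity of a matrix $M$ is the function $$R_M(r) = \min_{\operatorname{rank}(\widetilde{M}) \leq r} \operatorname{weight}(M - \widetilde{M}),$$ where the minimum is over complex matrices $\widetilde{M}$ of the same size as $M$ with rank at most $r$; that is, the minimum number of entries of $M$ that must be changed to reduce its rank to $r$ or less. The Discrete Fourier Transform matrix is the $n \times n$ matrix $FT(n) = (f_{jk})_{1 \leq j,k \leq n}$ defined by $f_{jk} = \omega^{(j-1)(k-1)}$, where $\omega = e^{2\pi i/n}$ and $i = \sqrt{ -1}$. Powers of $2$ include $1 = 2^0$. -}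

module Defs where

open import Algebra.Bundles.Raw using (RawRing)
import Algebra.Definitions.RawSemiring as RawSemiringDefs
open import Data.Fin.Base using (Fin; toℕ)
open import Data.Integer.Base using (+_)
import Data.Integer.Base as ℤ
import Data.Integer.Properties as ℤ
open import Data.List.Base using (allFin; cartesianProduct; filter; length)
open import Data.Nat.Base as ℕ using (ℕ; zero; suc; z≤n; s≤s)
import Data.Nat.Properties as ℕ
open import Data.Product.Base using (_×_; _,_; proj₁; proj₂; ∃-syntax)
open import Data.Rational.Base
open import Data.Rational.Properties
open import Data.Rational.Solver using (module +-*-Solver)
import Data.Rational.Unnormalised.Base as ℚᵘ
import Data.Rational.Unnormalised.Properties as ℚᵘ
open import Data.Sum.Base using (inj₁; inj₂)
open import Data.Vec.Functional using (Vector)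
open import Level using (0ℓ)
open import Relation.Binary.PropositionalEquality
  using (_≡_; refl; sym; trans; cong; cong₂; subst; subst₂)
open import Relation.Nullary using (Dec; ¬_)
open import Relation.Nullary.Decidable using (¬?; from-yes)

open +-*-Solver using (solve; _:=_; _:+_; _:*_; _:-_; :-_; con; Polynomial)

ι : ℕ → ℚ
ι n = + n / 1

ι-mono : ∀ {m n} → m ℕ.≤ n → ι m ≤ ι n
ι-mono {m} {n} m≤n = toℚᵘ-cancel-≤
  (ℚᵘ.≤-respˡ-≃ (ℚᵘ.≃-sym (toℚᵘ-fromℚᵘ (+ m ℚᵘ./ 1)))
    (ℚᵘ.≤-respʳ-≃ (ℚᵘ.≃-sym (toℚᵘ-fromℚᵘ (+ n ℚᵘ./ 1)))
      (ℚᵘ.*≤* (ℤ.*-monoʳ-≤-nonNeg (+ 1) (ℤ.+≤+ m≤n)))))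

ι-suc : ∀ n → ι (suc n) ≡ 1ℚ + ι n
ι-suc n = toℚᵘ-injective (ℚᵘ.≃-trans (toℚᵘ-fromℚᵘ (+ suc n ℚᵘ./ 1))
  (ℚᵘ.≃-sym (ℚᵘ.≃-trans (toℚᵘ-homo-+ 1ℚ (ι n))
    (ℚᵘ.≃-trans (ℚᵘ.+-congʳ (toℚᵘ 1ℚ) (toℚᵘ-fromℚᵘ (+ n ℚᵘ./ 1)))
      (ℚᵘ.*≡* (cong (ℤ._* + 1) (cong (λ x → + 1 ℤ.+ x) (ℤ.*-identityʳ (+ n)))))))))

suc-inverse : ∀ k → (+ 1 / suc k) * ι (suc k) ≡ 1ℚ
suc-inverse k = toℚᵘ-injective (ℚᵘ.≃-trans (toℚᵘ-homo-* (+ 1 / suc k) (ι (suc k)))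
  (ℚᵘ.≃-trans (ℚᵘ.*-cong (toℚᵘ-fromℚᵘ (+ 1 ℚᵘ./ suc k)) (toℚᵘ-fromℚᵘ (+ suc k ℚᵘ./ 1)))
    (ℚᵘ.*-inverseˡ (+ suc k ℚᵘ./ 1))))

archimedean : ∀ q → ∃[ n ] q ≤ ι n
archimedean q@(mkℚ n d-1 _) = ℤ.∣ n ∣ , toℚᵘ-cancel-≤
  (ℚᵘ.≤-respʳ-≃ (ℚᵘ.≃-sym (toℚᵘ-fromℚᵘ (+ ℤ.∣ n ∣ ℚᵘ./ 1))) (ℚᵘ.*≤* (bound n)))
  where
  bound : ∀ n → n ℤ.* + 1 ℤ.≤ + ℤ.∣ n ∣ ℤ.* + suc d-1
  bound (ℤ.+ n) = subst₂ ℤ._≤_ (ℤ.pos-* n 1) (ℤ.pos-* n (suc d-1))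
    (ℤ.+≤+ (ℕ.*-monoʳ-≤ n (s≤s z≤n)))
  bound ℤ.-[1+ n ] = ℤ.-≤+

0≤1/suc : ∀ k → 0ℚ ≤ + 1 / suc k
0≤1/suc k = nonNegative⁻¹ (+ 1 / suc k) {{normalize-nonNeg 1 (suc k)}}

*-mono-≤ : ∀ {a b c d} → 0ℚ ≤ a → a ≤ b → 0ℚ ≤ c → c ≤ d → a * c ≤ b * d
*-mono-≤ {a} {b} {c} {d} 0≤a a≤b 0≤c c≤d = ≤-trans
  (*-monoʳ-≤-nonNeg c {{nonNegative 0≤c}} a≤b)
  (*-monoˡ-≤-nonNeg b {{nonNegative (≤-trans 0≤a a≤b)}} c≤d)

*-monoˡ : ∀ {a b c} → 0ℚ ≤ a → b ≤ c → a * b ≤ a * c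
*-monoˡ {a} 0≤a = *-monoˡ-≤-nonNeg a {{nonNegative 0≤a}}

*-monoʳ : ∀ {a b c} → 0ℚ ≤ a → b ≤ c → b * a ≤ c * a
*-monoʳ {a} 0≤a = *-monoʳ-≤-nonNeg a {{nonNegative 0≤a}}

0≤* : ∀ {a b} → 0ℚ ≤ a → 0ℚ ≤ b → 0ℚ ≤ a * b
0≤* {a} {b} 0≤a 0≤b = subst (_≤ a * b) (*-zeroʳ a) (*-monoˡ 0≤a 0≤b)

a≤b⇒0≤b-a : ∀ {a b} → a ≤ b → 0ℚ ≤ b - a
a≤b⇒0≤b-a {a} {b} a≤b = subst (_≤ b - a) (+-inverseʳ a) (+-monoˡ-≤ (- a) a≤b)

∣∣≤ : ∀ {a b} → a ≤ b → - a ≤ b → ∣ a ∣ ≤ b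
∣∣≤ {a} a≤b -a≤b with ∣p∣≡p∨∣p∣≡-p a
... | inj₁ eq rewrite eq = a≤b
... | inj₂ eq rewrite eq = -a≤b

a≤∣a∣ : ∀ a → a ≤ ∣ a ∣
a≤∣a∣ a with ≤-total 0ℚ a
... | inj₁ 0≤a = ≤-reflexive (sym (0≤p⇒∣p∣≡p 0≤a))
... | inj₂ a≤0 = ≤-trans a≤0 (0≤∣p∣ a)

-a≤∣a∣ : ∀ a → - a ≤ ∣ a ∣
-a≤∣a∣ a = subst (- a ≤_) (∣-p∣≡∣p∣ a) (a≤∣a∣ (- a))

-- The ring solver is only fast on closed identities, hence these lemmas.
private
  +-interchange : ∀ x y z w → (x + y) + (z + w) ≡ (x + z) + (y + w)
  +-interchange = solve 4 (λ x y z w → (x :+ y) :+ (z :+ w) := (x :+ z) :+ (y :+ w)) refl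

  expand : ∀ x y z w → (x * z + y * w) + (x * w + y * z) ≡ (x + y) * (z + w)
  expand = solve 4 (λ x y z w →
    (x :* z :+ y :* w) :+ (x :* w :+ y :* z) := (x :+ y) :* (z :+ w)) refl

  chain : ∀ x y z → (x - y) + (y - z) ≡ x - z
  chain = solve 3 (λ x y z → (x :- y) :+ (y :- z) := x :- z) refl

  flip : ∀ x y → - (x - y) ≡ y - x
  flip = solve 2 (λ x y → :- (x :- y) := y :- x) refl

  swap : ∀ x y z w → (x + y) - (z + w) ≡ (x - z) + (y - w)
  swap = solve 4 (λ x y z w → (x :+ y) :- (z :+ w) := (x :- z) :+ (y :- w)) refl

  double : ∀ x → x + x ≡ ι 2 * x
  double = solve 1 (λ x → x :+ x := con (ι 2) :* x) refl

  triple : ∀ x → x + (x + x) ≡ ι 3 * x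
  triple = solve 1 (λ x → x :+ (x :+ x) := con (ι 3) :* x) refl

  minus-plus : ∀ x y → (x - y) + y ≡ x
  minus-plus = solve 2 (λ x y → (x :- y) :+ y := x) refl

  plus-minus : ∀ x y → (x + y) - x ≡ y
  plus-minus = solve 2 (λ x y → (x :+ y) :- x := y) refl

  factor : ∀ x y z → x * z + z * y ≡ (x + y) * z
  factor = solve 3 (λ x y z → x :* z :+ z :* y := (x :+ y) :* z) refl

  gather : ∀ x y → x + y + x ≡ y + ι 2 * x
  gather = solve 2 (λ x y → x :+ y :+ x := y :+ con (ι 2) :* x) refl

  pull : ∀ x y z → x * y * z ≡ y * (x * z)
  pull = solve 3 (λ x y z → x :* y :* z := y :* (x :* z)) refl

  shuffle : ∀ x y z w → x * (y * (z * w)) ≡ y * ((x * z) * w)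
  shuffle = solve 4 (λ x y z w → x :* (y :* (z :* w)) := y :* ((x :* z) :* w)) refl

  drop-zero : ∀ x y z → x * y - 0ℚ * z ≡ x * y
  drop-zero = solve 3 (λ x y z → x :* y :- con 0ℚ :* z := x :* y) refl

  drop-zero′ : ∀ x y z → x * y + 0ℚ * z ≡ x * y
  drop-zero′ = solve 3 (λ x y z → x :* y :+ con 0ℚ :* z := x :* y) refl

  re-difference : ∀ a b c d a′ b′ c′ d′ → (a * c - b * d) - (a′ * c′ - b′ * d′) ≡
    (a * (c - c′) - b * (d - d′)) + ((a - a′) * c′ - (b - b′) * d′)
  re-difference = solve 8 (λ a b c d a′ b′ c′ d′ →
    (a :* c :- b :* d) :- (a′ :* c′ :- b′ :* d′) :=
    (a :* (c :- c′) :- b :* (d :- d′)) :+ ((a :- a′) :* c′ :- (b :- b′) :* d′)) refl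

  im-difference : ∀ a b c d a′ b′ c′ d′ → (a * d + b * c) - (a′ * d′ + b′ * c′) ≡
    (a * (d - d′) + b * (c - c′)) + ((a - a′) * d′ + (b - b′) * c′)
  im-difference = solve 8 (λ a b c d a′ b′ c′ d′ →
    (a :* d :+ b :* c) :- (a′ :* d′ :+ b′ :* c′) :=
    (a :* (d :- d′) :+ b :* (c :- c′)) :+ ((a :- a′) :* d′ :+ (b :- b′) :* c′)) refl

infix 3 _+i_

record ℚ[i] : Set where
  constructor _+i_
  field re im : ℚ

open ℚ[i] public

infixl 6 _+ᵍ_ _-ᵍ_
infixl 7 _*ᵍ_ _·_
infix  8 -ᵍ_

_+ᵍ_ _*ᵍ_ _-ᵍ_ : ℚ[i] → ℚ[i] → ℚ[i]
(a +i b) +ᵍ (c +i d) = a + c +i b + d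
(a +i b) *ᵍ (c +i d) = a * c - b * d +i a * d + b * c
g -ᵍ h = re g - re h +i im g - im h

-ᵍ_ : ℚ[i] → ℚ[i]
-ᵍ (a +i b) = - a +i - b

_·_ : ℚ → ℚ[i] → ℚ[i]
q · (a +i b) = q * a +i q * b

0ᵍ 1ᵍ : ℚ[i]
0ᵍ = 0ℚ +i 0ℚ
1ᵍ = 1ℚ +i 0ℚ

-- The ℓ¹ norm: it is equivalent to the Euclidean modulus, so it gives the
-- same Cauchy and null sequences, and it stays within ℚ.
‖_‖ : ℚ[i] → ℚ
‖ a +i b ‖ = ∣ a ∣ + ∣ b ∣

0≤‖‖ : ∀ g → 0ℚ ≤ ‖ g ‖
0≤‖‖ (a +i b) = +-mono-≤ (0≤∣p∣ a) (0≤∣p∣ b)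

‖-‖ : ∀ g → ‖ -ᵍ g ‖ ≡ ‖ g ‖
‖-‖ (a +i b) = cong₂ _+_ (∣-p∣≡∣p∣ a) (∣-p∣≡∣p∣ b)

‖+‖ : ∀ g h → ‖ g +ᵍ h ‖ ≤ ‖ g ‖ + ‖ h ‖
‖+‖ (a +i b) (c +i d) = ≤-trans
  (+-mono-≤ (∣p+q∣≤∣p∣+∣q∣ a c) (∣p+q∣≤∣p∣+∣q∣ b d))
  (≤-reflexive (+-interchange (∣ a ∣) (∣ c ∣) (∣ b ∣) (∣ d ∣)))

‖*‖ : ∀ g h → ‖ g *ᵍ h ‖ ≤ ‖ g ‖ * ‖ h ‖
‖*‖ (a +i b) (c +i d) = ≤-trans
  (+-mono-≤ (∣p-q∣≤∣p∣+∣q∣ (a * c) (b * d)) (∣p+q∣≤∣p∣+∣q∣ (a * d) (b * c)))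
  (≤-reflexive (trans
    (cong₂ _+_ (cong₂ _+_ (∣p*q∣≡∣p∣*∣q∣ a c) (∣p*q∣≡∣p∣*∣q∣ b d))
               (cong₂ _+_ (∣p*q∣≡∣p∣*∣q∣ a d) (∣p*q∣≡∣p∣*∣q∣ b c)))
    (expand (∣ a ∣) (∣ b ∣) (∣ c ∣) (∣ d ∣))))

‖·‖ : ∀ {q} → 0ℚ ≤ q → ∀ g → ‖ q · g ‖ ≡ q * ‖ g ‖
‖·‖ {q} 0≤q (a +i b) = trans
  (cong₂ _+_ (trans (∣p*q∣≡∣p∣*∣q∣ q a) (cong (_* ∣ a ∣) (0≤p⇒∣p∣≡p 0≤q)))
             (trans (∣p*q∣≡∣p∣*∣q∣ q b) (cong (_* ∣ b ∣) (0≤p⇒∣p∣≡p 0≤q))))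
  (sym (*-distribˡ-+ q (∣ a ∣) (∣ b ∣)))

∣re∣≤‖‖ : ∀ g → ∣ re g ∣ ≤ ‖ g ‖
∣re∣≤‖‖ (a +i b) = subst (_≤ ∣ a ∣ + ∣ b ∣) (+-identityʳ (∣ a ∣)) (+-monoʳ-≤ (∣ a ∣) (0≤∣p∣ b))

g-g : ∀ g → g -ᵍ g ≡ 0ᵍ
g-g (a +i b) = cong₂ _+i_ (+-inverseʳ a) (+-inverseʳ b)

‖-‖-triangle : ∀ f g h → ‖ f -ᵍ h ‖ ≤ ‖ f -ᵍ g ‖ + ‖ g -ᵍ h ‖
‖-‖-triangle f g h = subst (λ k → ‖ k ‖ ≤ ‖ f -ᵍ g ‖ + ‖ g -ᵍ h ‖)
  (cong₂ _+i_ (chain (re f) (re g) (re h)) (chain (im f) (im g) (im h)))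
  (‖+‖ (f -ᵍ g) (g -ᵍ h))

‖-‖-sym : ∀ g h → ‖ g -ᵍ h ‖ ≡ ‖ h -ᵍ g ‖
‖-‖-sym g h = trans (sym (‖-‖ (g -ᵍ h)))
  (cong ‖_‖ (cong₂ _+i_ (flip (re g) (re h)) (flip (im g) (im h))))

-- A record rather than a plain definition, so that f can be inferred.
record IsCauchy (f : ℕ → ℚ[i]) : Set where
  constructor is-cauchy
  field
    modulus : ∀ ε → 0ℚ < ε → ∃[ N ] ∀ m n → N ℕ.≤ m → N ℕ.≤ n → ‖ f m -ᵍ f n ‖ ≤ ε

-- It suffices to reach C ε for a fixed C > 0.
rescale : ∀ {a} {P : ℚ → Set a} C → 0ℚ < C → (∀ ε → 0ℚ < ε → P (C * ε)) → ∀ ε → 0ℚ < ε → P ε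
rescale {P = P} C 0<C h ε 0<ε = subst P eq (h (1/C * ε) (positive⁻¹ (1/C * ε)))
  where
  instance
    C-pos = positive 0<C
    C-nonZero = pos⇒nonZero C
    ε-pos = positive 0<ε
  1/C = 1/ C
  instance
    1/C-pos = 1/pos⇒pos C
    pos* = pos*pos⇒pos 1/C ε
  eq : C * (1/C * ε) ≡ ε
  eq = trans (sym (*-assoc C 1/C ε)) (trans (cong (_* ε) (*-inverseʳ C)) (*-identityˡ ε))

cauchy-const : ∀ g → IsCauchy (λ _ → g)
cauchy-const g = is-cauchy λ ε 0<ε → 0 , λ _ _ _ _ → subst (_≤ ε) (sym (cong ‖_‖ (g-g g))) (<⇒≤ 0<ε)

cauchy-+ : ∀ {f h} → IsCauchy f → IsCauchy h → IsCauchy (λ n → f n +ᵍ h n)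
cauchy-+ {f} {h} cf ch = is-cauchy (rescale (ι 2) (from-yes (0ℚ <? ι 2)) λ ε 0<ε →
  let N₁ , p₁ = IsCauchy.modulus cf ε 0<ε
      N₂ , p₂ = IsCauchy.modulus ch ε 0<ε
  in N₁ ℕ.⊔ N₂ , λ m n N≤m N≤n → ≤-trans
    (subst (λ k → ‖ k ‖ ≤ ‖ f m -ᵍ f n ‖ + ‖ h m -ᵍ h n ‖)
      (sym (cong₂ _+i_ (swap (re (f m)) (re (h m)) (re (f n)) (re (h n)))
                       (swap (im (f m)) (im (h m)) (im (f n)) (im (h n)))))
      (‖+‖ (f m -ᵍ f n) (h m -ᵍ h n)))
    (≤-trans (+-mono-≤ (p₁ m n (ℕ.m⊔n≤o⇒m≤o N₁ N₂ N≤m) (ℕ.m⊔n≤o⇒m≤o N₁ N₂ N≤n))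
                       (p₂ m n (ℕ.m⊔n≤o⇒n≤o N₁ N₂ N≤m) (ℕ.m⊔n≤o⇒n≤o N₁ N₂ N≤n)))
             (≤-reflexive (double ε))))

cauchy-neg : ∀ {f} → IsCauchy f → IsCauchy (λ n → -ᵍ f n)
cauchy-neg {f} cf = is-cauchy λ ε 0<ε → let N , p = IsCauchy.modulus cf ε 0<ε in
  N , λ m n N≤m N≤n → subst (_≤ ε)
    (trans (sym (‖-‖ (f m -ᵍ f n)))
      (cong ‖_‖ (cong₂ _+i_ (neg-distrib-+ (re (f m)) (- re (f n)))
                            (neg-distrib-+ (im (f m)) (- im (f n))))))
    (p m n N≤m N≤n)

initial-bound : ∀ (f : ℕ → ℚ[i]) N → ∃[ B ] ∀ n → n ℕ.≤ N → ‖ f n ‖ ≤ B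
initial-bound f zero = ‖ f 0 ‖ , λ { zero z≤n → ≤-refl }
initial-bound f (suc N) with initial-bound f N
... | B , b = B ⊔ ‖ f (suc N) ‖ , go
  where
  go : ∀ n → n ℕ.≤ suc N → ‖ f n ‖ ≤ B ⊔ ‖ f (suc N) ‖
  go n n≤ with ℕ.m≤n⇒m<n∨m≡n n≤
  ... | inj₁ (s≤s n≤N) = ≤-trans (b n n≤N) (p≤p⊔q B (‖ f (suc N) ‖))
  ... | inj₂ refl = p≤q⊔p B (‖ f (suc N) ‖)

cauchy-bounded : ∀ {f} → IsCauchy f → ∃[ B ] (0ℚ < B) × (∀ n → ‖ f n ‖ ≤ B)
cauchy-bounded {f} cf with IsCauchy.modulus cf 1ℚ (from-yes (0ℚ <? 1ℚ))
... | N , c with initial-bound f N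
...   | B₀ , b = 1ℚ + B₀ , <-≤-trans (from-yes (0ℚ <? 1ℚ)) 1≤1+B₀ , go
  where
  0≤B₀ : 0ℚ ≤ B₀
  0≤B₀ = ≤-trans (0≤‖‖ (f 0)) (b 0 z≤n)
  1≤1+B₀ : 1ℚ ≤ 1ℚ + B₀
  1≤1+B₀ = +-monoʳ-≤ 1ℚ 0≤B₀
  go : ∀ n → ‖ f n ‖ ≤ 1ℚ + B₀
  go n with ℕ.≤-total n N
  ... | inj₁ n≤N = ≤-trans (b n n≤N)
    (subst (_≤ 1ℚ + B₀) (+-identityˡ B₀) (+-monoˡ-≤ B₀ (from-yes (0ℚ ≤? 1ℚ))))
  ... | inj₂ N≤n = ≤-trans
    (subst (λ k → ‖ k ‖ ≤ ‖ f n -ᵍ f N ‖ + ‖ f N ‖)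
      (cong₂ _+i_ (minus-plus (re (f n)) (re (f N))) (minus-plus (im (f n)) (im (f N))))
      (‖+‖ (f n -ᵍ f N) (f N)))
    (+-mono-≤ (c n N N≤n ℕ.≤-refl) (b N ℕ.≤-refl))

*ᵍ-difference : ∀ f h f′ h′ → (f *ᵍ h) -ᵍ (f′ *ᵍ h′) ≡ f *ᵍ (h -ᵍ h′) +ᵍ (f -ᵍ f′) *ᵍ h′
*ᵍ-difference (a +i b) (c +i d) (a′ +i b′) (c′ +i d′) =
  cong₂ _+i_ (re-difference a b c d a′ b′ c′ d′) (im-difference a b c d a′ b′ c′ d′)

‖*ᵍ-difference‖ : ∀ f h f′ h′ →
  ‖ (f *ᵍ h) -ᵍ (f′ *ᵍ h′) ‖ ≤ ‖ f ‖ * ‖ h -ᵍ h′ ‖ + ‖ f -ᵍ f′ ‖ * ‖ h′ ‖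
‖*ᵍ-difference‖ f h f′ h′ = ≤-trans (≤-reflexive (cong ‖_‖ (*ᵍ-difference f h f′ h′))) (≤-trans
  (‖+‖ (f *ᵍ (h -ᵍ h′)) ((f -ᵍ f′) *ᵍ h′)) (+-mono-≤ (‖*‖ f (h -ᵍ h′)) (‖*‖ (f -ᵍ f′) h′)))

combine : ∀ x y z w B B′ ε → 0ℚ ≤ x → x ≤ B → 0ℚ ≤ y → y ≤ ε →
  0ℚ ≤ z → z ≤ ε → 0ℚ ≤ w → w ≤ B′ → x * y + z * w ≤ (B + B′) * ε
combine x y z w B B′ ε 0≤x x≤B 0≤y y≤ε 0≤z z≤ε 0≤w w≤B′ = subst (x * y + z * w ≤_)
  (factor B B′ ε)
  (+-mono-≤ {x * y} {B * ε} {z * w} {ε * B′}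
    (*-mono-≤ {x} {B} {y} {ε} 0≤x x≤B 0≤y y≤ε) (*-mono-≤ {z} {ε} {w} {B′} 0≤z z≤ε 0≤w w≤B′))

cauchy-* : ∀ {f h} → IsCauchy f → IsCauchy h → IsCauchy (λ n → f n *ᵍ h n)
cauchy-* {f} {h} cf ch = let B , 0<B , bf = cauchy-bounded cf
                             B′ , 0<B′ , bh = cauchy-bounded ch in
  is-cauchy (rescale (B + B′) (+-mono-< 0<B 0<B′) λ ε 0<ε →
  let N₁ , p₁ = IsCauchy.modulus cf ε 0<ε
      N₂ , p₂ = IsCauchy.modulus ch ε 0<ε
  in N₁ ℕ.⊔ N₂ , λ m n N≤m N≤n → ≤-trans (‖*ᵍ-difference‖ (f m) (h m) (f n) (h n))
    (combine (‖ f m ‖) (‖ h m -ᵍ h n ‖) (‖ f m -ᵍ f n ‖) (‖ h n ‖) B B′ ε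
      (0≤‖‖ (f m)) (bf m) (0≤‖‖ (h m -ᵍ h n))
      (p₂ m n (ℕ.m⊔n≤o⇒n≤o N₁ N₂ N≤m) (ℕ.m⊔n≤o⇒n≤o N₁ N₂ N≤n))
      (0≤‖‖ (f m -ᵍ f n))
      (p₁ m n (ℕ.m⊔n≤o⇒m≤o N₁ N₂ N≤m) (ℕ.m⊔n≤o⇒m≤o N₁ N₂ N≤n)) (0≤‖‖ (h n)) (bh n)))

cauchy-· : ∀ q {f} → IsCauchy f → IsCauchy (λ n → q · f n)
cauchy-· q {f} cf = is-cauchy λ ε 0<ε →
  let N , p = IsCauchy.modulus (cauchy-* (cauchy-const (q +i 0ℚ)) cf) ε 0<ε in
  N , λ m n N≤m N≤n →
  subst (λ k → ‖ k ‖ ≤ ε) (cong₂ _-ᵍ_ (eq (f m)) (eq (f n))) (p m n N≤m N≤n)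
  where
  eq : ∀ g → (q +i 0ℚ) *ᵍ g ≡ q · g
  eq (a +i b) = cong₂ _+i_ (drop-zero q a b) (drop-zero′ q b a)

-- Partial sums dominated by a sequence that halves at each step

module Halving {a : ℕ → ℚ} (K : ℕ) (0≤a : ∀ k → 0ℚ ≤ a k)
               (halve : ∀ k → K ℕ.≤ k → ι 2 * a (suc k) ≤ a k) where

  tail : ∀ {S : ℕ → ℚ[i]} → (∀ k → ‖ S (suc k) -ᵍ S k ‖ ≤ a (suc k)) →
         ∀ k → K ℕ.≤ k → ∀ j → ‖ S (j ℕ.+ k) -ᵍ S k ‖ ≤ a k
  tail {S} step k K≤k j = ≤-trans (subst (_≤ ‖ S (j ℕ.+ k) -ᵍ S k ‖ + a (j ℕ.+ k))
      (+-identityʳ (‖ S (j ℕ.+ k) -ᵍ S k ‖))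
      (+-monoʳ-≤ (‖ S (j ℕ.+ k) -ᵍ S k ‖) (0≤a (j ℕ.+ k)))) (go j)
    where
    go : ∀ j → ‖ S (j ℕ.+ k) -ᵍ S k ‖ + a (j ℕ.+ k) ≤ a k
    go zero = ≤-reflexive (trans (cong (λ h → ‖ h ‖ + a k) (g-g (S k))) (+-identityˡ (a k)))
    go (suc j) = ≤-trans
      (+-monoˡ-≤ (a (suc (j ℕ.+ k))) (≤-trans (‖-‖-triangle (S (suc (j ℕ.+ k))) (S (j ℕ.+ k)) (S k))
        (+-monoˡ-≤ (‖ S (j ℕ.+ k) -ᵍ S k ‖) (step (j ℕ.+ k)))))
      (≤-trans (≤-reflexive (gather (a (suc (j ℕ.+ k))) (‖ S (j ℕ.+ k) -ᵍ S k ‖)))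
        (≤-trans (+-monoʳ-≤ (‖ S (j ℕ.+ k) -ᵍ S k ‖)
                   (halve (j ℕ.+ k) (ℕ.≤-trans K≤k (ℕ.m≤n+m k j))))
          (go j)))

  decay : ∀ j → ι (suc j) * a (j ℕ.+ K) ≤ a K
  decay zero = ≤-reflexive (*-identityˡ (a K))
  decay (suc j) = ≤-trans
    (*-monoʳ (0≤a (suc (j ℕ.+ K)))
      (≤-trans (≤-reflexive (ι-suc (suc j)))
        (≤-trans (+-monoˡ-≤ (ι (suc j)) (ι-mono {1} {suc j} (s≤s z≤n)))
          (≤-reflexive (double (ι (suc j)))))))
    (≤-trans (≤-reflexive (pull (ι 2) (ι (suc j)) (a (suc (j ℕ.+ K)))))
      (≤-trans (*-monoˡ (ι-mono {0} {suc j} z≤n) (halve (j ℕ.+ K) (ℕ.m≤n+m K j)))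
        (decay j)))

  small : ∀ ε → 0ℚ < ε → ∃[ j ] a (j ℕ.+ K) ≤ ε
  small ε 0<ε = j , *-cancelˡ-≤-pos (ι (suc j)) {{normalize-pos (suc j) 1}}
    (≤-trans (decay j) (≤-trans aK≤ (*-monoʳ (<⇒≤ 0<ε) (ι-mono (ℕ.n≤1+n j)))))
    where
    instance
      ε-pos = positive 0<ε
      ε-nonZero = pos⇒nonZero ε
    ar = archimedean (a K * 1/ ε)
    j = proj₁ ar
    aK≤ : a K ≤ ι j * ε
    aK≤ = subst (_≤ ι j * ε)
      (trans (*-assoc (a K) (1/ ε) ε)
        (trans (cong (a K *_) (*-inverseˡ ε)) (*-identityʳ (a K))))
      (*-monoʳ (<⇒≤ 0<ε) (proj₂ ar))

  antitone : ∀ k → K ℕ.≤ k → ∀ j → a (j ℕ.+ k) ≤ a k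
  antitone k K≤k zero = ≤-refl
  antitone k K≤k (suc j) = ≤-trans
    (subst₂ _≤_ (+-identityʳ x) (double x) (+-monoʳ-≤ x (0≤a (suc (j ℕ.+ k)))))
    (≤-trans (halve (j ℕ.+ k) (ℕ.≤-trans K≤k (ℕ.m≤n+m k j))) (antitone k K≤k j))
    where x = a (suc (j ℕ.+ k))

  cauchy : ∀ {S : ℕ → ℚ[i]} → (∀ k → ‖ S (suc k) -ᵍ S k ‖ ≤ a (suc k)) → IsCauchy S
  cauchy {S} step = is-cauchy (rescale (ι 2) (from-yes (0ℚ <? ι 2)) λ ε 0<ε →
    let j , aj≤ε = small ε 0<ε
        k = j ℕ.+ K
        near : ∀ m → k ℕ.≤ m → ‖ S m -ᵍ S k ‖ ≤ ε
        near m k≤m = ≤-trans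
          (subst (λ l → ‖ S l -ᵍ S k ‖ ≤ a k) (ℕ.m∸n+n≡m k≤m)
            (tail {S} step k (ℕ.m≤n+m K j) (m ℕ.∸ k)))
          aj≤ε
    in k , λ m n k≤m k≤n → ≤-trans (‖-‖-triangle (S m) (S k) (S n))
      (≤-trans (+-mono-≤ (near m k≤m) (subst (_≤ ε) (‖-‖-sym (S n) (S k)) (near n k≤n)))
        (≤-reflexive (double ε))))

expTerm : ℚ[i] → ℕ → ℚ[i]
expTerm g zero    = 1ᵍ
expTerm g (suc k) = (+ 1 / suc k) · (g *ᵍ expTerm g k)

-- expSum N g = Σ_{k ≤ N} gᵏ / k!
expSum : ℕ → ℚ[i] → ℚ[i]
expSum zero    g = expTerm g zero
expSum (suc N) g = expSum N g +ᵍ expTerm g (suc N)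

-- Bᵏ / k!
majorant : ℚ → ℕ → ℚ
majorant B zero    = 1ℚ
majorant B (suc k) = (+ 1 / suc k) * (B * majorant B k)

0≤majorant : ∀ {B} → 0ℚ ≤ B → ∀ k → 0ℚ ≤ majorant B k
0≤majorant 0≤B zero    = from-yes (0ℚ ≤? 1ℚ)
0≤majorant 0≤B (suc k) = 0≤* (0≤1/suc k) (0≤* 0≤B (0≤majorant 0≤B k))

suc*majorant : ∀ B k → ι (suc k) * majorant B (suc k) ≡ B * majorant B k
suc*majorant B k = trans (sym (*-assoc (ι (suc k)) (+ 1 / suc k) x))
  (trans (cong (_* x) (trans (*-comm (ι (suc k)) (+ 1 / suc k)) (suc-inverse k))) (*-identityˡ x))
  where x = B * majorant B k

majorant-halve : ∀ {B} → 0ℚ ≤ B → ∀ K → ι 2 * B ≤ ι K →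
  ∀ k → K ℕ.≤ k → ι 2 * majorant B (suc k) ≤ majorant B k
majorant-halve {B} 0≤B K 2B≤K k K≤k = ≤-trans
  (≤-reflexive (shuffle (ι 2) (+ 1 / suc k) B (majorant B k)))
  (≤-trans (*-monoˡ (0≤1/suc k) (*-monoʳ (0≤majorant 0≤B k)
             (≤-trans 2B≤K (ι-mono (ℕ.m≤n⇒m≤1+n K≤k)))))
    (≤-reflexive (trans (sym (*-assoc (+ 1 / suc k) (ι (suc k)) (majorant B k)))
      (trans (cong (_* majorant B k) (suc-inverse k)) (*-identityˡ (majorant B k))))))

‖expTerm‖ : ∀ {B} g → ‖ g ‖ ≤ B → ∀ k → ‖ expTerm g k ‖ ≤ majorant B k
‖expTerm‖ g g≤B zero = ≤-refl
‖expTerm‖ {B} g g≤B (suc k) = ≤-trans (≤-reflexive (‖·‖ (0≤1/suc k) (g *ᵍ expTerm g k)))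
  (*-monoˡ (0≤1/suc k) (≤-trans (‖*‖ g (expTerm g k))
    (*-mono-≤ (0≤‖‖ g) g≤B (0≤‖‖ (expTerm g k)) (‖expTerm‖ g g≤B k))))

expSum-step : ∀ g N → expSum (suc N) g -ᵍ expSum N g ≡ expTerm g (suc N)
expSum-step g N = cong₂ _+i_ (plus-minus (re (expSum N g)) (re (expTerm g (suc N))))
                             (plus-minus (im (expSum N g)) (im (expTerm g (suc N))))

expSum-tail : ∀ {B} g → ‖ g ‖ ≤ B → ∀ K → ι 2 * B ≤ ι K → ∀ k → K ℕ.≤ k →
  ∀ j → ‖ expSum (j ℕ.+ k) g -ᵍ expSum k g ‖ ≤ majorant B k
expSum-tail {B} g g≤B K 2B≤K = tail {λ N → expSum N g} λ N →
  subst (λ h → ‖ h ‖ ≤ majorant B (suc N)) (sym (expSum-step g N)) (‖expTerm‖ g g≤B (suc N))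
  where
  0≤B = ≤-trans (0≤‖‖ g) g≤B
  open Halving K (0≤majorant 0≤B) (majorant-halve 0≤B K 2B≤K)

cauchy-expTerm : ∀ {f} → IsCauchy f → ∀ k → IsCauchy (λ n → expTerm (f n) k)
cauchy-expTerm cf zero    = cauchy-const 1ᵍ
cauchy-expTerm cf (suc k) = cauchy-· (+ 1 / suc k) (cauchy-* cf (cauchy-expTerm cf k))

cauchy-expSum : ∀ {f} → IsCauchy f → ∀ N → IsCauchy (λ n → expSum N (f n))
cauchy-expSum cf zero    = cauchy-const 1ᵍ
cauchy-expSum cf (suc N) = cauchy-+ (cauchy-expSum cf N) (cauchy-expTerm cf (suc N))

cauchy-exp : ∀ {f} → IsCauchy f → IsCauchy (λ n → expSum n (f n))
cauchy-exp {f} cf = is-cauchy (rescale (ι 3) (from-yes (0ℚ <? ι 3)) λ ε 0<ε →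
  let j , aj≤ε = small ε 0<ε
      k = j ℕ.+ K
      N , p = IsCauchy.modulus (cauchy-expSum cf k) ε 0<ε
      near : ∀ m → k ℕ.≤ m → ‖ expSum m (f m) -ᵍ expSum k (f m) ‖ ≤ ε
      near m k≤m = ≤-trans
        (subst (λ l → ‖ expSum l (f m) -ᵍ expSum k (f m) ‖ ≤ majorant B k) (ℕ.m∸n+n≡m k≤m)
          (expSum-tail (f m) (b m) K 2B≤K k (ℕ.m≤n+m K j) (m ℕ.∸ k)))
        aj≤ε
  in k ℕ.⊔ N , λ m n ≤m ≤n → ≤-trans
    (‖-‖-triangle (expSum m (f m)) (expSum k (f m)) (expSum n (f n)))
    (≤-trans
      (+-mono-≤ (near m (ℕ.m⊔n≤o⇒m≤o k N ≤m))
        (≤-trans (‖-‖-triangle (expSum k (f m)) (expSum k (f n)) (expSum n (f n)))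
          (+-mono-≤ (p m n (ℕ.m⊔n≤o⇒n≤o k N ≤m) (ℕ.m⊔n≤o⇒n≤o k N ≤n))
            (subst (_≤ ε) (‖-‖-sym (expSum n (f n)) (expSum k (f n)))
              (near n (ℕ.m⊔n≤o⇒m≤o k N ≤n))))))
      (≤-reflexive (triple ε))))
  where
  bounded = cauchy-bounded cf
  B = proj₁ bounded
  0<B = proj₁ (proj₂ bounded)
  b = proj₂ (proj₂ bounded)
  K = proj₁ (archimedean (ι 2 * B))
  2B≤K : ι 2 * B ≤ ι K
  2B≤K = proj₂ (archimedean (ι 2 * B))
  open Halving K (0≤majorant (<⇒≤ 0<B)) (majorant-halve (<⇒≤ 0<B) K 2B≤K)

-- ½π is the limit of Bishop's iteration x ↦ x + cos x, which contracts towards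
-- the zero of cos in [3/2, 17/10].  As Σ (i x)ᵏ / k! has real part cos x, each
-- step uses a partial sum of that series, longer by one term every time.
-- cos-½π and ½π-bounds below confirm that the limit is that zero.

iℚ : ℚ → ℚ[i]
iℚ x = 0ℚ +i x

½πSeq : ℕ → ℚ
½πSeq zero    = + 8 / 5
½πSeq (suc N) = ½πSeq N + re (expSum (N ℕ.+ 7) (iℚ (½πSeq N)))

private
  cos₆ : ℚ → ℚ
  cos₆ x = 1ℚ - ½ * (x * x) + (+ 1 / 24) * ((x * x) * (x * x)) - (+ 1 / 720) * ((x * x) * ((x * x) * (x * x)))

  polyTerm : Polynomial 1 → ℕ → Polynomial 1 × Polynomial 1
  polyTerm x zero    = con 1ℚ , con 0ℚ
  polyTerm x (suc k) = let a , b = polyTerm x k in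
    con (+ 1 / suc k) :* (con 0ℚ :* a :- x :* b) , con (+ 1 / suc k) :* (con 0ℚ :* b :+ x :* a)

  polySum : ℕ → Polynomial 1 → Polynomial 1
  polySum zero    x = con 1ℚ
  polySum (suc N) x = polySum N x :+ proj₁ (polyTerm x (suc N))

  cos₆-expSum : ∀ x → re (expSum 7 (iℚ x)) ≡ cos₆ x
  cos₆-expSum = solve 1 (λ x → polySum 7 x :=
    con 1ℚ :- con ½ :* (x :* x) :+ con (+ 1 / 24) :* ((x :* x) :* (x :* x))
      :- con (+ 1 / 720) :* ((x :* x) :* ((x :* x) :* (x :* x)))) refl

  quotient : ℚ → ℚ → ℚ
  quotient u v = ½ - (+ 1 / 24) * (u + v) + (+ 1 / 720) * (u * u + u * v + v * v)

  cos₆-difference : ∀ x y →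
    (x + cos₆ x) - (y + cos₆ y) ≡ (1ℚ - (x + y) * quotient (x * x) (y * y)) * (x - y)
  cos₆-difference = solve 2 (λ x y →
    (x :+ c x) :- (y :+ c y) := (con 1ℚ :- (x :+ y) :* q (x :* x) (y :* y)) :* (x :- y)) refl
    where
    c : Polynomial 2 → Polynomial 2
    c x = con 1ℚ :- con ½ :* (x :* x) :+ con (+ 1 / 24) :* ((x :* x) :* (x :* x))
            :- con (+ 1 / 720) :* ((x :* x) :* ((x :* x) :* (x :* x)))
    q : Polynomial 2 → Polynomial 2 → Polynomial 2
    q u v = con ½ :- con (+ 1 / 24) :* (u :+ v) :+ con (+ 1 / 720) :* (u :* u :+ u :* v :+ v :* v)

  minus-neg : ∀ a x → a + - (- (x - a)) ≡ x
  minus-neg = solve 2 (λ a x → a :+ :- (:- (x :- a)) := x) refl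

  swap-* : ∀ x y z → x * (y * z) ≡ y * (x * z)
  swap-* = solve 3 (λ x y z → x :* (y :* z) := y :* (x :* z)) refl

  collect : ∀ d k m → d * (k * m) + d * m ≡ (1ℚ + k) * (d * m)
  collect = solve 3 (λ d k m → d :* (k :* m) :+ d :* m := (con 1ℚ :+ k) :* (d :* m)) refl

  scale-difference : ∀ s a b → s * a - s * b ≡ s * (a - b)
  scale-difference = solve 3 (λ s a b → s :* a :- s :* b := s :* (a :- b)) refl

  double-difference : ∀ a s b t → ((a + s) - (b + t)) - (a - b) ≡ s - t
  double-difference = solve 4 (λ a s b t → ((a :+ s) :- (b :+ t)) :- (a :- b) := s :- t) refl

  step-split : ∀ x a y b c d → (x + a) - (y + b) ≡ ((x + c) - (y + d)) + ((a - b) - (c - d))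
  step-split = solve 6 (λ x a y b c d →
    (x :+ a) :- (y :+ b) := ((x :+ c) :- (y :+ d)) :+ ((a :- b) :- (c :- d))) refl

  centre-split : ∀ t a e c → t - a ≡ (t - (a + e)) + (c + (e - c))
  centre-split = solve 4 (λ t a e c → t :- a := (t :- (a :+ e)) :+ (c :+ (e :- c))) refl

  next-split : ∀ y e e′ → (y + (e + e′)) - y ≡ ((y + e) - y) + e′
  next-split = solve 3 (λ y e e′ → (y :+ (e :+ e′)) :- y := ((y :+ e) :- y) :+ e′) refl

  telescope : ∀ y e e′ → ((y + e) - y) - (e - e′) ≡ e′
  telescope = solve 3 (λ y e e′ → ((y :+ e) :- y) :- (e :- e′) := e′) refl

  fifths : ∀ x → (+ 1 / 5) * x + x * (+ 4 / 45) ≡ (+ 13 / 45) * x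
  fifths = solve 1 (λ x → con (+ 1 / 5) :* x :+ x :* con (+ 4 / 45) := con (+ 13 / 45) :* x) refl

-- x lies in [3/2, 17/10].
Near : ℚ → Set
Near x = ∣ x - + 8 / 5 ∣ ≤ + 1 / 10

near-≤ : ∀ x → Near x → x ≤ + 17 / 10
near-≤ x p = subst (_≤ + 17 / 10) (minus-plus x (+ 8 / 5))
  (+-monoˡ-≤ (+ 8 / 5) {x - + 8 / 5} {+ 1 / 10} (≤-trans (a≤∣a∣ (x - + 8 / 5)) p))

near-≥ : ∀ x → Near x → + 3 / 2 ≤ x
near-≥ x p = subst (+ 3 / 2 ≤_) (minus-neg (+ 8 / 5) x)
  (+-monoʳ-≤ (+ 8 / 5) { - (+ 1 / 10)} { - (- (x - + 8 / 5))}
    (neg-antimono-≤ (≤-trans (-a≤∣a∣ (x - + 8 / 5)) p)))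

near-‖‖ : ∀ x → Near x → ‖ iℚ x ‖ ≤ ι 2
near-‖‖ x p = subst (_≤ ι 2) (sym (+-identityˡ ∣ x ∣))
  (subst (_≤ ι 2) (sym (0≤p⇒∣p∣≡p 0≤x)) (≤-trans (near-≤ x p) (from-yes (+ 17 / 10 ≤? ι 2))))
  where
  0≤x = ≤-trans (from-yes (0ℚ ≤? + 3 / 2)) (near-≥ x p)

private
  module Bounds (x y : ℚ) (nx : Near x) (ny : Near y) where
    lo hi lo² hi² Wlo Whi s u v W : ℚ
    lo = + 3 / 2
    hi = + 17 / 10
    lo² = lo * lo
    hi² = hi * hi
    Wlo = ½ - (+ 1 / 24) * (hi² + hi²) + (+ 1 / 720) * (lo² * lo² + lo² * lo² + lo² * lo²)
    Whi = ½ - (+ 1 / 24) * (lo² + lo²) + (+ 1 / 720) * (hi² * hi² + hi² * hi² + hi² * hi²)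
    s = x + y
    u = x * x
    v = y * y
    W = quotient u v

    0≤lo : 0ℚ ≤ lo
    0≤lo = from-yes (0ℚ ≤? + 3 / 2)
    0≤x : 0ℚ ≤ x
    0≤x = ≤-trans 0≤lo (near-≥ x nx)
    0≤y : 0ℚ ≤ y
    0≤y = ≤-trans 0≤lo (near-≥ y ny)
    u≥ : lo² ≤ u
    u≥ = *-mono-≤ {lo} {x} {lo} {x} 0≤lo (near-≥ x nx) 0≤lo (near-≥ x nx)
    v≥ : lo² ≤ v
    v≥ = *-mono-≤ {lo} {y} {lo} {y} 0≤lo (near-≥ y ny) 0≤lo (near-≥ y ny)
    u≤ : u ≤ hi²
    u≤ = *-mono-≤ {x} {hi} {x} {hi} 0≤x (near-≤ x nx) 0≤x (near-≤ x nx)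
    v≤ : v ≤ hi²
    v≤ = *-mono-≤ {y} {hi} {y} {hi} 0≤y (near-≤ y ny) 0≤y (near-≤ y ny)

    quotient-mono : ∀ p q p′ q′ r t r′ t′ → p ≤ p′ → q ≤ q′ → 0ℚ ≤ r → r ≤ r′ → 0ℚ ≤ t → t ≤ t′ →
      ½ - (+ 1 / 24) * (p′ + q′) + (+ 1 / 720) * (r * r + r * t + t * t) ≤
      ½ - (+ 1 / 24) * (p + q) + (+ 1 / 720) * (r′ * r′ + r′ * t′ + t′ * t′)
    quotient-mono p q p′ q′ r t r′ t′ p≤ q≤ 0≤r r≤ 0≤t t≤ =
      +-mono-≤ {½ - (+ 1 / 24) * (p′ + q′)} {½ - (+ 1 / 24) * (p + q)}
               {(+ 1 / 720) * (r * r + r * t + t * t)} {(+ 1 / 720) * (r′ * r′ + r′ * t′ + t′ * t′)}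
        (+-monoʳ-≤ ½ { - ((+ 1 / 24) * (p′ + q′))} { - ((+ 1 / 24) * (p + q))}
          (neg-antimono-≤ (*-monoˡ {+ 1 / 24} {p + q} {p′ + q′} (0≤1/suc 23)
            (+-mono-≤ {p} {p′} {q} {q′} p≤ q≤))))
        (*-monoˡ {+ 1 / 720} {r * r + r * t + t * t} {r′ * r′ + r′ * t′ + t′ * t′} (0≤1/suc 719)
          (+-mono-≤ {r * r + r * t} {r′ * r′ + r′ * t′} {t * t} {t′ * t′}
            (+-mono-≤ {r * r} {r′ * r′} {r * t} {r′ * t′}
              (*-mono-≤ {r} {r′} {r} {r′} 0≤r r≤ 0≤r r≤)
              (*-mono-≤ {r} {r′} {t} {t′} 0≤r r≤ 0≤t t≤))
            (*-mono-≤ {t} {t′} {t} {t′} 0≤t t≤ 0≤t t≤)))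

    0≤u : 0ℚ ≤ u
    0≤u = ≤-trans (from-yes (0ℚ ≤? lo²)) u≥
    0≤v : 0ℚ ≤ v
    0≤v = ≤-trans (from-yes (0ℚ ≤? lo²)) v≥

    W≥ : Wlo ≤ W
    W≥ = quotient-mono u v hi² hi² lo² lo² u v u≤ v≤
           (from-yes (0ℚ ≤? lo²)) u≥ (from-yes (0ℚ ≤? lo²)) v≥
    W≤ : W ≤ Whi
    W≤ = quotient-mono lo² lo² u v u v hi² hi² u≥ v≥ 0≤u u≤ 0≤v v≤

    0≤Wlo : 0ℚ ≤ Wlo
    0≤Wlo = from-yes (0ℚ ≤? Wlo)

    sW≥ : (lo + lo) * Wlo ≤ s * W
    sW≥ = *-mono-≤ {lo + lo} {s} {Wlo} {W} (from-yes (0ℚ ≤? lo + lo))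
      (+-mono-≤ {lo} {x} {lo} {y} (near-≥ x nx) (near-≥ y ny)) 0≤Wlo W≥
    sW≤ : s * W ≤ (hi + hi) * Whi
    sW≤ = *-mono-≤ {s} {hi + hi} {W} {Whi}
      (+-mono-≤ {0ℚ} {x} {0ℚ} {y} 0≤x 0≤y)
      (+-mono-≤ {x} {hi} {y} {hi} (near-≤ x nx) (near-≤ y ny)) (≤-trans 0≤Wlo W≥) W≤

    slope : ∣ 1ℚ - s * W ∣ ≤ + 1 / 5
    slope = ∣∣≤
      (≤-trans (+-monoʳ-≤ 1ℚ { - (s * W)} { - ((lo + lo) * Wlo)} (neg-antimono-≤ sW≥))
        (from-yes (1ℚ - (lo + lo) * Wlo ≤? + 1 / 5)))
      (≤-trans (≤-reflexive (flip 1ℚ (s * W)))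
        (≤-trans (+-monoˡ-≤ (- 1ℚ) {s * W} {(hi + hi) * Whi} sW≤)
          (from-yes ((hi + hi) * Whi - 1ℚ ≤? + 1 / 5))))

    contract : ∣ (x + cos₆ x) - (y + cos₆ y) ∣ ≤ (+ 1 / 5) * ∣ x - y ∣
    contract = ≤-trans
      (≤-reflexive (trans (cong ∣_∣ (cos₆-difference x y)) (∣p*q∣≡∣p∣*∣q∣ (1ℚ - s * W) (x - y))))
      (*-monoʳ {∣ x - y ∣} {∣ 1ℚ - s * W ∣} {+ 1 / 5} (0≤∣p∣ (x - y)) slope)

-- Bᵏ⁻¹ / (k - 1)!, a Lipschitz constant of gᵏ / k! on the ball of radius B.
lipschitz : ℚ → ℕ → ℚ
lipschitz B zero    = 0ℚ
lipschitz B (suc k) = majorant B k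

0≤lipschitz : ∀ {B} → 0ℚ ≤ B → ∀ k → 0ℚ ≤ lipschitz B k
0≤lipschitz 0≤B zero    = ≤-refl
0≤lipschitz 0≤B (suc k) = 0≤majorant 0≤B k

lipschitz-step : ∀ B δ k →
  (+ 1 / suc k) * (B * (δ * lipschitz B k) + δ * majorant B k) ≡ δ * majorant B k
lipschitz-step B δ k = trans (cong ((+ 1 / suc k) *_) (trans
    (cong (_+ δ * M) (trans (swap-* B δ (lipschitz B k)) (cong (δ *_) (shift k))))
    (trans (collect δ (ι k) M) (cong (_* (δ * M)) (sym (ι-suc k))))))
  (trans (sym (*-assoc (+ 1 / suc k) (ι (suc k)) (δ * M)))
    (trans (cong (_* (δ * M)) (suc-inverse k)) (*-identityˡ (δ * M))))
  where
  M = majorant B k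
  shift : ∀ k → B * lipschitz B k ≡ ι k * majorant B k
  shift zero    = *-zeroʳ B
  shift (suc k) = sym (suc*majorant B k)

expTerm-lipschitz : ∀ {B} g h → ‖ g ‖ ≤ B → ‖ h ‖ ≤ B → ∀ k →
  ‖ expTerm g k -ᵍ expTerm h k ‖ ≤ ‖ g -ᵍ h ‖ * lipschitz B k
expTerm-lipschitz {B} g h g≤B h≤B zero    = ≤-reflexive (sym (*-zeroʳ ‖ g -ᵍ h ‖))
expTerm-lipschitz {B} g h g≤B h≤B (suc k) = ≤-trans
  (≤-reflexive (trans
    (cong ‖_‖ (cong₂ _+i_ (scale-difference c (re (g *ᵍ T)) (re (h *ᵍ T′)))
                          (scale-difference c (im (g *ᵍ T)) (im (h *ᵍ T′)))))
    (‖·‖ (0≤1/suc k) ((g *ᵍ T) -ᵍ (h *ᵍ T′)))))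
  (≤-trans
    (*-monoˡ {c} {‖ (g *ᵍ T) -ᵍ (h *ᵍ T′) ‖} {B * (δ * lipschitz B k) + δ * majorant B k} (0≤1/suc k)
      (≤-trans (‖*ᵍ-difference‖ g T h T′)
        (+-mono-≤ {‖ g ‖ * ‖ T -ᵍ T′ ‖} {B * (δ * lipschitz B k)} {δ * ‖ T′ ‖} {δ * majorant B k}
          (*-mono-≤ {‖ g ‖} {B} {‖ T -ᵍ T′ ‖} {δ * lipschitz B k}
            (0≤‖‖ g) g≤B (0≤‖‖ (T -ᵍ T′)) (expTerm-lipschitz g h g≤B h≤B k))
          (*-monoˡ {δ} {‖ T′ ‖} {majorant B k} (0≤‖‖ (g -ᵍ h)) (‖expTerm‖ h h≤B k)))))
    (≤-reflexive (lipschitz-step B δ k)))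
  where
  c = + 1 / suc k
  T = expTerm g k
  T′ = expTerm h k
  δ = ‖ g -ᵍ h ‖

expSum-lipschitz : ∀ g h → ‖ g ‖ ≤ ι 2 → ‖ h ‖ ≤ ι 2 → ∀ j →
  ‖ (expSum (j ℕ.+ 7) g -ᵍ expSum (j ℕ.+ 7) h) -ᵍ (expSum 7 g -ᵍ expSum 7 h) ‖
    ≤ ‖ g -ᵍ h ‖ * (+ 4 / 45)
expSum-lipschitz g h g≤2 h≤2 = tail {S} step 7 (ℕ.m≤m+n 5 2)
  where
  δ = ‖ g -ᵍ h ‖
  S : ℕ → ℚ[i]
  S k = expSum k g -ᵍ expSum k h
  a : ℕ → ℚ
  a k = δ * lipschitz (ι 2) k
  0≤2 : 0ℚ ≤ ι 2
  0≤2 = from-yes (0ℚ ≤? ι 2)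
  halve : ∀ k → 5 ℕ.≤ k → ι 2 * a (suc k) ≤ a k
  halve (suc k) (s≤s 4≤k) = ≤-trans
    (≤-reflexive (swap-* (ι 2) δ (majorant (ι 2) (suc k))))
    (*-monoˡ {δ} {ι 2 * majorant (ι 2) (suc k)} {majorant (ι 2) k} (0≤‖‖ (g -ᵍ h))
      (majorant-halve 0≤2 4 ≤-refl k 4≤k))
  step : ∀ k → ‖ S (suc k) -ᵍ S k ‖ ≤ a (suc k)
  step k = ≤-trans
    (≤-reflexive (cong ‖_‖ (cong₂ _+i_
      (double-difference (re (expSum k g)) (re (expTerm g (suc k))) (re (expSum k h)) (re (expTerm h (suc k))))
      (double-difference (im (expSum k g)) (im (expTerm g (suc k))) (im (expSum k h)) (im (expTerm h (suc k)))))))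
    (expTerm-lipschitz g h g≤2 h≤2 (suc k))
  open Halving {a} 5 (λ k → 0≤* (0≤‖‖ (g -ᵍ h)) (0≤lipschitz 0≤2 k)) halve

iterate-contract : ∀ N x y → Near x → Near y →
  ∣ (x + re (expSum (N ℕ.+ 7) (iℚ x))) - (y + re (expSum (N ℕ.+ 7) (iℚ y))) ∣
    ≤ (+ 13 / 45) * ∣ x - y ∣
iterate-contract N x y nx ny = ≤-trans
  (≤-reflexive (cong ∣_∣ (step-split x (re Ex) y (re Ey) (re Ex₇) (re Ey₇))))
  (≤-trans (∣p+q∣≤∣p∣+∣q∣ ((x + re Ex₇) - (y + re Ey₇)) ((re Ex - re Ey) - (re Ex₇ - re Ey₇)))
    (≤-trans
      (+-mono-≤ {∣ (x + re Ex₇) - (y + re Ey₇) ∣} {(+ 1 / 5) * ∣ x - y ∣}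
                {∣ (re Ex - re Ey) - (re Ex₇ - re Ey₇) ∣} {∣ x - y ∣ * (+ 4 / 45)}
        (subst₂ (λ c d → ∣ (x + c) - (y + d) ∣ ≤ (+ 1 / 5) * ∣ x - y ∣)
          (sym (cos₆-expSum x)) (sym (cos₆-expSum y)) (Bounds.contract x y nx ny))
        (≤-trans (∣re∣≤‖‖ ((Ex -ᵍ Ey) -ᵍ (Ex₇ -ᵍ Ey₇)))
          (subst (λ d → ‖ (Ex -ᵍ Ey) -ᵍ (Ex₇ -ᵍ Ey₇) ‖ ≤ d * (+ 4 / 45)) (+-identityˡ ∣ x - y ∣)
            (expSum-lipschitz (iℚ x) (iℚ y) (near-‖‖ x nx) (near-‖‖ y ny) N))))
      (≤-reflexive (fifths ∣ x - y ∣))))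
  where
  Ex = expSum (N ℕ.+ 7) (iℚ x)
  Ey = expSum (N ℕ.+ 7) (iℚ y)
  Ex₇ = expSum 7 (iℚ x)
  Ey₇ = expSum 7 (iℚ y)

near-centre : Near (+ 8 / 5)
near-centre = from-yes (∣ + 8 / 5 - + 8 / 5 ∣ ≤? + 1 / 10)

near-iterate : ∀ N x → Near x → Near (x + re (expSum (N ℕ.+ 7) (iℚ x)))
near-iterate N x nx = ≤-trans
  (≤-reflexive (cong ∣_∣ (centre-split t a (re E) (re E₇))))
  (≤-trans (∣p+q∣≤∣p∣+∣q∣ (t - (a + re E)) (re E₇ + (re E - re E₇)))
    (≤-trans
      (+-mono-≤ {∣ t - (a + re E) ∣} {(+ 13 / 45) * (+ 1 / 10)} {∣ re E₇ + (re E - re E₇) ∣} {(+ 1 / 30) + (+ 8 / 315)}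
        (≤-trans (iterate-contract N x a nx near-centre)
          (*-monoˡ {+ 13 / 45} {∣ x - a ∣} {+ 1 / 10} (from-yes (0ℚ ≤? + 13 / 45)) nx))
        (≤-trans (∣p+q∣≤∣p∣+∣q∣ (re E₇) (re E - re E₇))
          (+-mono-≤ {∣ re E₇ ∣} {+ 1 / 30} {∣ re E - re E₇ ∣} {+ 8 / 315}
            (from-yes (∣ re E₇ ∣ ≤? + 1 / 30))
            (≤-trans (∣re∣≤‖‖ (E -ᵍ E₇))
              (expSum-tail (iℚ a) (near-‖‖ a near-centre) 4 ≤-refl 7 (ℕ.m≤m+n 4 3) N)))))
      (from-yes ((+ 13 / 45) * (+ 1 / 10) + ((+ 1 / 30) + (+ 8 / 315)) ≤? + 1 / 10))))
  where
  a = + 8 / 5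
  t = x + re (expSum (N ℕ.+ 7) (iℚ x))
  E = expSum (N ℕ.+ 7) (iℚ a)
  E₇ = expSum 7 (iℚ a)

near-½π : ∀ N → Near (½πSeq N)
near-½π zero    = near-centre
near-½π (suc N) = near-iterate N (½πSeq N) (near-½π N)

½π-bounds : ∀ N → (+ 3 / 2 ≤ ½πSeq N) × (½πSeq N ≤ + 17 / 10)
½π-bounds N = near-≥ (½πSeq N) (near-½π N) , near-≤ (½πSeq N) (near-½π N)

-- 2¹⁻ᵏ
halves : ℕ → ℚ
halves zero    = ι 2
halves (suc k) = ½ * halves k

0≤halves : ∀ k → 0ℚ ≤ halves k
0≤halves zero    = from-yes (0ℚ ≤? ι 2)
0≤halves (suc k) = 0≤* {½} {halves k} (from-yes (0ℚ ≤? ½)) (0≤halves k)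

private
  2*½ : ∀ x → ι 2 * (½ * x) ≡ x
  2*½ = solve 1 (λ x → con (ι 2) :* (con ½ :* x) := x) refl

  half-mono : ∀ {x y} → ι 2 * x ≤ y → x ≤ ½ * y
  half-mono {x} {y} p = *-cancelˡ-≤-pos (ι 2) (subst (ι 2 * x ≤_) (sym (2*½ y)) p)

  tenths : ∀ x → (+ 1 / 10) * (½ * x) ≡ ½ * ((+ 1 / 10) * x)
  tenths x = swap-* (+ 1 / 10) ½ x

  merge : ∀ x → (+ 13 / 45) * x + (+ 1 / 10) * x ≡ (+ 7 / 18) * x
  merge = solve 1 (λ x → con (+ 13 / 45) :* x :+ con (+ 1 / 10) :* x := con (+ 7 / 18) :* x) refl

majorant-halves : ∀ N → majorant (ι 2) (suc (N ℕ.+ 7)) ≤ (+ 1 / 10) * halves (suc N)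
majorant-halves zero = from-yes (majorant (ι 2) 8 ≤? (+ 1 / 10) * halves 1)
majorant-halves (suc N) = subst (majorant (ι 2) (suc (suc N ℕ.+ 7)) ≤_)
  (sym (tenths (halves (suc N))))
  (half-mono {majorant (ι 2) (suc (suc N ℕ.+ 7))} {(+ 1 / 10) * halves (suc N)}
    (≤-trans (majorant-halve (from-yes (0ℚ ≤? ι 2)) 4 ≤-refl (suc (N ℕ.+ 7)) (ℕ.m≤n⇒m≤1+n (ℕ.≤-trans (ℕ.m≤m+n 4 3) (ℕ.m≤n+m 7 N))))
      (majorant-halves N)))

½π-step : ∀ N → ∣ ½πSeq (suc N) - ½πSeq N ∣ ≤ halves (suc N)
½π-step zero = from-yes (∣ ½πSeq 1 - ½πSeq 0 ∣ ≤? halves 1)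
½π-step (suc N) = ≤-trans
  (≤-reflexive (cong ∣_∣ (next-split y (re E) (re e))))
  (≤-trans (∣p+q∣≤∣p∣+∣q∣ ((y + re E) - y) (re e))
    (≤-trans
      (+-mono-≤ {∣ (y + re E) - y ∣} {(+ 13 / 45) * h} {∣ re e ∣} {(+ 1 / 10) * h}
        (≤-trans (iterate-contract N y (½πSeq N) (near-½π (suc N)) (near-½π N))
          (*-monoˡ {+ 13 / 45} {∣ y - ½πSeq N ∣} {h} (from-yes (0ℚ ≤? + 13 / 45)) (½π-step N)))
        (≤-trans (∣re∣≤‖‖ e)
          (≤-trans (‖expTerm‖ (iℚ y) (near-‖‖ y (near-½π (suc N))) (suc (N ℕ.+ 7)))
            (majorant-halves N))))
      (≤-trans (≤-reflexive (merge h))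
        (*-monoʳ {h} {+ 7 / 18} {½} (0≤halves (suc N)) (from-yes (+ 7 / 18 ≤? ½))))))
  where
  y = ½πSeq (suc N)
  E = expSum (N ℕ.+ 7) (iℚ y)
  e = expTerm (iℚ y) (suc (N ℕ.+ 7))
  h = halves (suc N)

private
  module Halves = Halving {halves} 0 0≤halves (λ k _ → ≤-reflexive (2*½ (halves k)))

cauchy-½π : IsCauchy (λ N → ½πSeq N +i 0ℚ)
cauchy-½π = Halves.cauchy {λ N → ½πSeq N +i 0ℚ} λ N →
  subst (_≤ halves (suc N)) (sym (+-identityʳ ∣ ½πSeq (suc N) - ½πSeq N ∣)) (½π-step N)

cos-½π : ∀ ε → 0ℚ < ε →
  ∃[ N ] ∀ n → N ℕ.≤ n → ∣ re (expSum n (iℚ (½πSeq n))) ∣ ≤ ε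
cos-½π = rescale (ι 2) (from-yes (0ℚ <? ι 2)) λ ε 0<ε →
  let j , j-small = Halves.small ε 0<ε
      k , k-small = Tail.small ε 0<ε
  in j ℕ.⊔ (k ℕ.+ 4) , λ n N≤n →
    let j≤n = subst (ℕ._≤ n) (sym (ℕ.+-identityʳ j)) (ℕ.m⊔n≤o⇒m≤o j (k ℕ.+ 4) N≤n)
        k≤n = ℕ.m⊔n≤o⇒n≤o j (k ℕ.+ 4) N≤n
    in ≤-trans (bound n (ℕ.≤-trans (ℕ.m≤n+m 4 k) k≤n))
      (≤-trans
        (+-mono-≤ {halves (suc n)} {ε} {majorant (ι 2) n} {ε}
          (≤-trans (subst (λ l → halves l ≤ halves (j ℕ.+ 0))
                     (ℕ.m∸n+n≡m (ℕ.m≤n⇒m≤1+n j≤n)) (Halves.antitone (j ℕ.+ 0) z≤n (suc n ℕ.∸ (j ℕ.+ 0))))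
                   j-small)
          (≤-trans (subst (λ l → majorant (ι 2) l ≤ majorant (ι 2) (k ℕ.+ 4))
                     (ℕ.m∸n+n≡m k≤n) (Tail.antitone (k ℕ.+ 4) (ℕ.m≤n+m 4 k) (n ℕ.∸ (k ℕ.+ 4))))
                   k-small))
        (≤-reflexive (double ε)))
  where
  0≤2 : 0ℚ ≤ ι 2
  0≤2 = from-yes (0ℚ ≤? ι 2)
  module Tail = Halving {majorant (ι 2)} 4 (0≤majorant 0≤2) (majorant-halve 0≤2 4 ≤-refl)
  bound : ∀ n → 4 ℕ.≤ n → ∣ re (expSum n (iℚ (½πSeq n))) ∣ ≤ halves (suc n) + majorant (ι 2) n
  bound n 4≤n = ≤-trans
    (≤-reflexive (cong ∣_∣ (sym (telescope (½πSeq n) (re E) (re E₀)))))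
    (≤-trans (∣p-q∣≤∣p∣+∣q∣ ((½πSeq n + re E) - ½πSeq n) (re E - re E₀))
      (+-mono-≤ {∣ (½πSeq n + re E) - ½πSeq n ∣} {halves (suc n)} {∣ re E - re E₀ ∣} {majorant (ι 2) n}
        (½π-step n)
        (≤-trans (∣re∣≤‖‖ (E -ᵍ E₀))
          (subst (λ l → ‖ expSum l g -ᵍ E₀ ‖ ≤ majorant (ι 2) n) (ℕ.+-comm 7 n)
            (expSum-tail g (near-‖‖ (½πSeq n) (near-½π n)) 4 ≤-refl n 4≤n 7)))))
    where
    g = iℚ (½πSeq n)
    E = expSum (n ℕ.+ 7) g
    E₀ = expSum n g

-- ℂ is the completion of ℚ(i): Cauchy sequences of Gaussian rationals, equal
-- when their difference is null.
record ℂ : Set where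
  constructor mkℂ
  field
    seq    : ℕ → ℚ[i]
    cauchy : IsCauchy seq

open ℂ public

infix  4 _≈_
infixl 6 _+ᶜ_ _-ᶜ_
infixl 7 _*ᶜ_
infix  8 -ᶜ_

record _≈_ (x y : ℂ) : Set where
  constructor mk≈
  field
    modulus : ∀ ε → 0ℚ < ε → ∃[ N ] ∀ n → N ℕ.≤ n → ‖ seq x n -ᵍ seq y n ‖ ≤ ε

_+ᶜ_ _*ᶜ_ : ℂ → ℂ → ℂ
x +ᶜ y = mkℂ (λ n → seq x n +ᵍ seq y n) (cauchy-+ (cauchy x) (cauchy y))
x *ᶜ y = mkℂ (λ n → seq x n *ᵍ seq y n) (cauchy-* (cauchy x) (cauchy y))

-ᶜ_ : ℂ → ℂ
-ᶜ x = mkℂ (λ n → -ᵍ seq x n) (cauchy-neg (cauchy x))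

_-ᶜ_ : ℂ → ℂ → ℂ
x -ᶜ y = x +ᶜ (-ᶜ y)

fromℚ[i] : ℚ[i] → ℂ
fromℚ[i] g = mkℂ (λ _ → g) (cauchy-const g)

fromℚ : ℚ → ℂ
fromℚ q = fromℚ[i] (q +i 0ℚ)

0ᶜ 1ᶜ 𝕚 : ℂ
0ᶜ = fromℚ[i] 0ᵍ
1ᶜ = fromℚ[i] 1ᵍ
𝕚  = fromℚ[i] (0ℚ +i 1ℚ)

-- The exponential series, summed along the diagonal: the n-th approximation
-- takes the terms of degree at most n at the n-th approximation of z.  On a
-- bounded set the series converges uniformly, so this represents Σ zᵏ / k!.
exp : ℂ → ℂ
exp z = mkℂ (λ n → expSum n (seq z n)) (cauchy-exp (cauchy z))

π : ℂ
π = fromℚ (ι 2) *ᶜ mkℂ (λ n → ½πSeq n +i 0ℚ) cauchy-½π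

ℂ-rawRing : RawRing 0ℓ 0ℓ
ℂ-rawRing = record
  { Carrier = ℂ ; _≈_ = _≈_ ; _+_ = _+ᶜ_ ; _*_ = _*ᶜ_ ; -_ = -ᶜ_ ; 0# = 0ᶜ ; 1# = 1ᶜ }

open RawSemiringDefs (RawRing.rawSemiring ℂ-rawRing) public using (_^_; sum)

Matrix : ℕ → ℕ → Set
Matrix m n = Vector (Vector ℂ n) m

_-ᴹ_ : ∀ {m n} → Matrix m n → Matrix m n → Matrix m n
(A -ᴹ B) i j = A i j -ᶜ B i j

LinearlyIndependent : ∀ {s m} → Vector (Vector ℂ m) s → Set
LinearlyIndependent {s} v =
  ∀ (c : Vector ℂ s) → (∀ i → sum (λ k → c k *ᶜ v k i) ≈ 0ᶜ) → ∀ k → c k ≈ 0ᶜ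

columns : ∀ {m n s} → Matrix m n → Vector (Fin n) s → Vector (Vector ℂ m) s
columns A c k i = A i (c k)

-- The rank is the largest number of linearly independent columns.  It is a
-- relation because equality in ℂ is undecidable; the same holds for the weight.
HasRank : ∀ {m n} → Matrix m n → ℕ → Set
HasRank {n = n} A ρ =
  (∃[ c ] LinearlyIndependent {ρ} (columns A c)) ×
  (∀ s (c : Vector (Fin n) s) → LinearlyIndependent (columns A c) → s ℕ.≤ ρ)

weight : ∀ {m n} (A : Matrix m n) → (∀ i j → Dec (A i j ≈ 0ᶜ)) → ℕ
weight {m} {n} A zero? =
  length (filter (λ (i , j) → ¬? (zero? i j)) (cartesianProduct (allFin m) (allFin n)))

HasWeight : ∀ {m n} → Matrix m n → ℕ → Set
HasWeight A w = ∃[ zero? ] weight A zero? ≡ w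

IsMinimum : (ℕ → Set) → ℕ → Set
IsMinimum P v = P v × (∀ w → P w → v ℕ.≤ w)

-- IsRigidity M r v : R_M(r) = v
IsRigidity : ∀ {m n} → Matrix m n → ℕ → ℕ → Set
IsRigidity {m} {n} M r = IsMinimum λ w →
  ∃[ M̃ ] (∃[ ρ ] HasRank {m} {n} M̃ ρ × ρ ℕ.≤ r) × HasWeight (M -ᴹ M̃) w

-- e^{2πi/n}
ω : ∀ n .{{_ : ℕ.NonZero n}} → ℂ
ω n = exp (fromℚ (+ 2 / n) *ᶜ (π *ᶜ 𝕚))

-- Indices start at 0, so the exponent (j - 1)(k - 1) becomes j k.
FT : ∀ n .{{_ : ℕ.NonZero n}} → Matrix n n
FT n j k = ω n ^ (toℕ j ℕ.* toℕ k)

module Submission where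

{- Write n = q m with m = 2r.  The rows m J + t and columns q u + K, for fixed
J, K < q, form an m × m block, and these q² blocks partition the matrix.  In the
block (J, K), column u of FT(n) consists of consecutive powers of
x_u = ω^(q u + K).  Since ω^(n/2) = -1, no difference x_u - x_u′ with u ≠ u′ is a
zero divisor, so by a Vandermonde argument the columns of the block are linearly
independent.  If fewer than r of them met a changed entry, the other r + 1 would
be independent columns of a matrix of rank at most r.  So each block contains at
least r changed entries, which makes q² r = n² / (4r) in total.

The equation ω^(n/2) = -1 follows from exp (x + y) = exp x exp y: the definition
of π gives cos (π/2) = 0, so e^(-iπ/2), being the conjugate of e^(iπ/2), equals
-e^(iπ/2), and hence (e^(iπ/2))² = -1. -}

open import Algebra.Bundles using (CommutativeRing)
open import Algebra.Bundles.Raw using (RawMonoid)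
import Algebra.Definitions.RawMonoid as RawMonoidDefs
import Algebra.Properties.Semiring.Mult as SemiringMult
open import Algebra.Structures using (IsCommutativeRing)
open import Data.Fin.Base using (Fin; zero; suc; toℕ; fromℕ<; combine; remQuot)
import Data.Fin.Properties as Fin
open import Data.Integer.Base as ℤ using (+_)
import Data.Integer.Properties as ℤ
open import Data.List.Base using (List; length; filter; cartesianProduct; allFin)
open import Data.List.Membership.Propositional using (_∈_)
open import Data.List.Membership.Propositional.Properties
  using (∈-filter⁺; ∈-cartesianProduct⁺; ∈-allFin)
open import Data.List.Membership.Setoid.Properties using (index-injective)
open import Data.Nat.Base as ℕ using (ℕ; zero; suc; NonZero; s≤s; z≤n)
import Data.Nat.Properties as ℕ
open import Data.Nat.Properties using (m*n≢0)
open import Data.Nat.Tactic.RingSolver using (solve-∀)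
open import Data.Product.Base using (_×_; _,_; ∃-syntax; proj₁; proj₂)
open import Data.Product.Properties using (,-injective)
open import Data.Rational.Base as ℚ using (ℚ; 0ℚ; 1ℚ; ½; ∣_∣)
import Data.Rational.Properties as ℚ
open import Data.Rational.Solver using (module +-*-Solver)
import Data.Rational.Unnormalised.Base as ℚᵘ
import Data.Rational.Unnormalised.Properties as ℚᵘ
open import Data.Sum.Base using (_⊎_; inj₁; inj₂)
open import Data.Vec.Functional using (Vector)
open import Function.Base using (_∘_)
open import Function.Definitions using (Injective)
open import Level using (0ℓ)
open import Relation.Binary.Definitions using (tri<; tri≈; tri>)
open import Relation.Binary.PropositionalEquality as ≡ using (_≡_; _≢_)
open import Relation.Binary.Structures using (IsEquivalence)
open import Relation.Nullary.Decidable using (Dec; yes; no; ¬?; decidable-stable; from-yes)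
open import Relation.Nullary.Negation using (¬_; contradiction)
open import Relation.Unary using (Pred; Decidable)

-- Roots of unity in a commutative ring

even∨odd : ∀ n → ∃[ h ] (n ≡ 2 ℕ.* h ⊎ n ≡ suc (2 ℕ.* h))
even∨odd zero    = 0 , inj₁ ≡.refl
even∨odd (suc n) with even∨odd n
... | h , inj₁ n≡2h   = h , inj₂ (≡.cong suc n≡2h)
... | h , inj₂ n≡2h+1 = suc h , inj₁ (≡.trans (≡.cong suc n≡2h+1) (≡.sym (ℕ.*-suc 2 h)))

translate : ∀ q k {i j} → i ℕ.≤ j → q ℕ.* i ℕ.+ k ℕ.+ q ℕ.* (j ℕ.∸ i) ≡ q ℕ.* j ℕ.+ k
translate q k {i} {j} i≤j = begin
  q ℕ.* i ℕ.+ k ℕ.+ q ℕ.* (j ℕ.∸ i)     ≡⟨ ℕ.+-assoc (q ℕ.* i) k _ ⟩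
  q ℕ.* i ℕ.+ (k ℕ.+ q ℕ.* (j ℕ.∸ i))   ≡⟨ ≡.cong (q ℕ.* i ℕ.+_) (ℕ.+-comm k _) ⟩
  q ℕ.* i ℕ.+ (q ℕ.* (j ℕ.∸ i) ℕ.+ k)   ≡⟨ ℕ.+-assoc (q ℕ.* i) _ k ⟨
  q ℕ.* i ℕ.+ q ℕ.* (j ℕ.∸ i) ℕ.+ k     ≡⟨ ≡.cong (ℕ._+ k) (ℕ.*-distribˡ-+ q i (j ℕ.∸ i)) ⟨
  q ℕ.* (i ℕ.+ (j ℕ.∸ i)) ℕ.+ k         ≡⟨ ≡.cong (λ e → q ℕ.* e ℕ.+ k) (ℕ.m+[n∸m]≡n i≤j) ⟩
  q ℕ.* j ℕ.+ k ∎
  where open ≡.≡-Reasoning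

module RootsOfUnity {c ℓ} (R : CommutativeRing c ℓ) where
  open CommutativeRing R hiding (zero)
  open import Algebra.Properties.Ring ring
  open import Algebra.Properties.CommutativeSemiring.Exp commutativeSemiring
  open import Algebra.Properties.Semiring.Sum semiring
  open import Algebra.Properties.CommutativeSemigroup *-commutativeSemigroup
    using (x∙yz≈y∙xz; xy∙z≈xz∙y)
  open import Relation.Binary.Reasoning.Setoid setoid

  -- That x - y is not a zero divisor is all the Vandermonde argument requires of two nodes;
  -- inverses never enter.
  Separated : Carrier → Carrier → Set _
  Separated x y = ∀ u → x * u ≈ y * u → u ≈ 0#

  -- Induction on the number of nodes. Subtracting x₀ times equation t from equation t + 1
  -- multiplies each coefficient aₗ by xₗ - x₀. This removes the zeroth node, so the induction
  -- hypothesis kills the other products, and separation cancels the factors xₗ - x₀.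
  vandermonde : ∀ {n} (x a : Vector Carrier n) → (∀ {i j} → i ≢ j → Separated (x i) (x j)) →
    (∀ t → t ℕ.< n → sum (λ l → a l * x l ^ t) ≈ 0#) → ∀ l → a l ≈ 0#
  vandermonde {suc n} x a sep vanish = λ where
      zero    → head≈0
      (suc l) → tail≈0 l
    where
    b : Vector Carrier (suc n)
    b l = a l * (x l + - x zero)

    split : ∀ t l → b l * x l ^ t ≈ a l * x l ^ suc t + - x zero * (a l * x l ^ t)
    split t l = begin
      a l * (x l + - x zero) * x l ^ t                    ≈⟨ *-assoc _ _ _ ⟩
      a l * ((x l + - x zero) * x l ^ t)                  ≈⟨ *-congˡ (distribʳ _ _ _) ⟩
      a l * (x l * x l ^ t + - x zero * x l ^ t)          ≈⟨ distribˡ _ _ _ ⟩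
      a l * x l ^ suc t + a l * (- x zero * x l ^ t)      ≈⟨ +-congˡ (x∙yz≈y∙xz _ _ _) ⟩
      a l * x l ^ suc t + - x zero * (a l * x l ^ t)      ∎

    b-vanish : ∀ t → t ℕ.< n → sum (λ l → b (suc l) * x (suc l) ^ t) ≈ 0#
    b-vanish t t<n = begin
      sum (λ l → b (suc l) * x (suc l) ^ t)
        ≈⟨ +-identityˡ _ ⟨
      0# + sum (λ l → b (suc l) * x (suc l) ^ t)
        -- `b zero` contains the factor x₀ - x₀, so the sum may be extended to index zero.
        ≈⟨ +-congʳ (trans (*-congʳ (trans (*-congˡ (-‿inverseʳ (x zero))) (zeroʳ _))) (zeroˡ _)) ⟨
      sum (λ l → b l * x l ^ t)
        ≈⟨ sum-cong-≋ (split t) ⟩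
      sum (λ l → a l * x l ^ suc t + - x zero * (a l * x l ^ t))
        ≈⟨ ∑-distrib-+ (λ l → a l * x l ^ suc t) (λ l → - x zero * (a l * x l ^ t)) ⟩
      sum (λ l → a l * x l ^ suc t) + sum (λ l → - x zero * (a l * x l ^ t))
        ≈⟨ +-cong (vanish (suc t) (s≤s t<n)) (sym (*-distribˡ-sum (- x zero) (λ l → a l * x l ^ t))) ⟩
      0# + - x zero * sum (λ l → a l * x l ^ t)
        ≈⟨ +-congˡ (trans (*-congˡ (vanish t (ℕ.m≤n⇒m≤1+n t<n))) (zeroʳ _)) ⟩
      0# + 0#
        ≈⟨ +-identityˡ 0# ⟩
      0# ∎

    tail≈0 : ∀ l → a (suc l) ≈ 0#
    tail≈0 l = sep {suc l} {zero} (λ ()) (a (suc l)) (x∙y⁻¹≈ε⇒x≈y _ _ (begin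
      x (suc l) * a (suc l) + - (x zero * a (suc l))   ≈⟨ +-congˡ (-‿distribˡ-* _ _) ⟩
      x (suc l) * a (suc l) + - x zero * a (suc l)     ≈⟨ distribʳ _ _ _ ⟨
      (x (suc l) + - x zero) * a (suc l)               ≈⟨ *-comm _ _ ⟩
      b (suc l)                                        ≈⟨ vandermonde (x ∘ suc) (b ∘ suc)
                                                            (λ i≢j → sep (i≢j ∘ Fin.suc-injective)) b-vanish l ⟩
      0# ∎))

    -- Once all other coefficients vanish, equation t = 0 reads `a zero` = 0.
    head≈0 : a zero ≈ 0#
    head≈0 = begin
      a zero
        ≈⟨ *-identityʳ _ ⟨
      a zero * 1#
        ≈⟨ +-identityʳ _ ⟨
      a zero * 1# + 0#
        ≈⟨ +-congˡ (trans (sum-cong-≋ (λ l → trans (*-congʳ (tail≈0 l)) (zeroˡ _))) (sum-replicate-zero n)) ⟨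
      sum (λ l → a l * x l ^ 0)
        ≈⟨ vanish 0 (s≤s z≤n) ⟩
      0# ∎

  -1^odd : ∀ h → (- 1#) ^ suc (2 ℕ.* h) ≈ - 1#
  -1^odd h = begin
    - 1# * (- 1#) ^ (2 ℕ.* h)   ≈⟨ *-congˡ (^-assocʳ (- 1#) 2 h) ⟨
    - 1# * ((- 1#) ^ 2) ^ h     ≈⟨ *-congˡ (^-congˡ h -1^2) ⟩
    - 1# * 1# ^ h               ≈⟨ *-congˡ (1^ h) ⟩
    - 1# * 1#                   ≈⟨ *-identityʳ _ ⟩
    - 1# ∎
    where
    -1^2 : (- 1#) ^ 2 ≈ 1#
    -1^2 = begin
      - 1# * (- 1# * 1#)   ≈⟨ *-congˡ (*-identityʳ _) ⟩
      - 1# * - 1#          ≈⟨ -1*x≈-x (- 1#) ⟩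
      - - 1#               ≈⟨ -‿involutive 1# ⟩
      1# ∎
    1^ : ∀ h → 1# ^ h ≈ 1#
    1^ zero    = refl
    1^ (suc h) = trans (*-identityˡ _) (1^ h)

  -- For odd d, raising ζ^d to the power 2^a gives (-1)^d = -1. An even d is halved while ζ is
  -- replaced by ζ² and a by a - 1. Since 0 < d < 2^(a+1), the halving meets an odd number before a
  -- runs out.
  power-reaching-minus-one : ∀ a ζ → ζ ^ (2 ℕ.^ a) ≈ - 1# →
    ∀ d → 0 ℕ.< d → d ℕ.< 2 ℕ.^ suc a → ∃[ p ] (ζ ^ d) ^ p ≈ - 1#
  power-reaching-minus-one a ζ ζ^≈-1 d 0<d d< with even∨odd d
  ... | h , inj₂ ≡.refl = 2 ℕ.^ a , (begin
    (ζ ^ d) ^ (2 ℕ.^ a)   ≈⟨ ^-assocʳ ζ d (2 ℕ.^ a) ⟩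
    ζ ^ (d ℕ.* 2 ℕ.^ a)   ≡⟨ ≡.cong (ζ ^_) (ℕ.*-comm d (2 ℕ.^ a)) ⟩
    ζ ^ (2 ℕ.^ a ℕ.* d)   ≈⟨ ^-assocʳ ζ (2 ℕ.^ a) d ⟨
    (ζ ^ (2 ℕ.^ a)) ^ d   ≈⟨ ^-congˡ d ζ^≈-1 ⟩
    (- 1#) ^ d            ≈⟨ -1^odd h ⟩
    - 1# ∎)
  power-reaching-minus-one a ζ ζ^≈-1 d 0<d d< | zero , inj₁ ≡.refl = contradiction 0<d ℕ.n≮0
  -- For a = 0 the bound leaves only d = 1, which is odd.
  power-reaching-minus-one zero ζ ζ^≈-1 d 0<d d< | suc h , inj₁ ≡.refl =
    contradiction d< (ℕ.≤⇒≯ (ℕ.*-monoʳ-≤ 2 (s≤s {n = h} z≤n)))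
  power-reaching-minus-one (suc a) ζ ζ^≈-1 d 0<d d< | suc h , inj₁ ≡.refl =
    let p , eq = power-reaching-minus-one a (ζ ^ 2) (trans (^-assocʳ ζ 2 (2 ℕ.^ a)) ζ^≈-1)
                   (suc h) (s≤s z≤n) (ℕ.*-cancelˡ-< 2 (suc h) (2 ℕ.^ suc a) d<)
    in p , trans (^-congˡ p (sym (^-assocʳ ζ 2 (suc h)))) eq

  module _ (2-torsion-free : ∀ u → u + u ≈ 0# → u ≈ 0#) where

    -- If z fixes u, so does every power of z. One of these is -1, hence -u = u and 2u = 0.
    fixed⇒0 : ∀ z p → z ^ p ≈ - 1# → ∀ u → z * u ≈ u → u ≈ 0#
    fixed⇒0 z p z^p≈-1 u zu≈u = 2-torsion-free u (begin
      u + u           ≈⟨ +-congʳ (fixed p) ⟨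
      z ^ p * u + u   ≈⟨ +-congʳ (trans (*-congʳ z^p≈-1) (-1*x≈-x u)) ⟩
      - u + u         ≈⟨ -‿inverseˡ u ⟩
      0# ∎)
      where
      fixed : ∀ p → z ^ p * u ≈ u
      fixed zero    = *-identityˡ u
      fixed (suc p) = begin
        z * z ^ p * u   ≈⟨ *-assoc _ _ _ ⟩
        z * (z ^ p * u) ≈⟨ *-congˡ (fixed p) ⟩
        z * u           ≈⟨ zu≈u ⟩
        u ∎

    module _ (ω : Carrier) (q a : ℕ) (ω^≈-1 : ω ^ (q ℕ.* 2 ℕ.^ a) ≈ - 1#) where

      -- Some power of ω is -1, so ω is a unit: multiplying ω x = ω y by the remaining power of ω
      -- gives -x = -y.
      ω-regular : ∀ j u v → ω ^ j * u ≈ ω ^ j * v → u ≈ v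
      ω-regular zero    u v eq = trans (sym (*-identityˡ u)) (trans eq (*-identityˡ v))
      ω-regular (suc j) u v eq = ω-regular j u v
        (cancel (q ℕ.* 2 ℕ.^ a) ω^≈-1 (trans (sym (*-assoc _ _ _)) (trans eq (*-assoc _ _ _))))
        where
        cancel : ∀ h {x y} → ω ^ h ≈ - 1# → ω * x ≈ ω * y → x ≈ y
        -- Exponent zero would mean 1 = -1; without 2-torsion the ring is then trivial.
        cancel zero {x} {y} 1≈-1 _ = trans (all≈0 x) (sym (all≈0 y))
          where
          all≈0 : ∀ x → x ≈ 0#
          all≈0 x = 2-torsion-free x (begin
            x + x            ≈⟨ +-congʳ (*-identityˡ x) ⟨
            1# * x + x       ≈⟨ +-congʳ (trans (*-congʳ 1≈-1) (-1*x≈-x x)) ⟩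
            - x + x          ≈⟨ -‿inverseˡ x ⟩
            0# ∎)
        cancel (suc h) {x} {y} ω^≈-1 ωx≈ωy = -‿injective (begin
          - x                ≈⟨ -1*x≈-x x ⟨
          - 1# * x           ≈⟨ *-congʳ ω^≈-1 ⟨
          ω * ω ^ h * x      ≈⟨ xy∙z≈xz∙y _ _ _ ⟩
          ω * x * ω ^ h      ≈⟨ *-congʳ ωx≈ωy ⟩
          ω * y * ω ^ h      ≈⟨ xy∙z≈xz∙y _ _ _ ⟩
          ω * ω ^ h * y      ≈⟨ *-congʳ ω^≈-1 ⟩
          - 1# * y           ≈⟨ -1*x≈-x y ⟩
          - y ∎)

      -- The two nodes differ by the factor z = (ω^q)^(j-i). Cancelling the unit ω^(q i + k) leaves
      -- z u = u, and some power of z is -1 because (ω^q)^(2^a) = -1 and 0 < j - i < 2^(a+1).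
      separated-< : ∀ k i j → i ℕ.< j → j ℕ.< 2 ℕ.^ suc a →
        Separated (ω ^ (q ℕ.* j ℕ.+ k)) (ω ^ (q ℕ.* i ℕ.+ k))
      separated-< k i j i<j j< u eq =
        let p , z^p≈-1 = power-reaching-minus-one a (ω ^ q) (trans (^-assocʳ ω q _) ω^≈-1)
                           (j ℕ.∸ i) (ℕ.m<n⇒0<n∸m i<j) (ℕ.≤-<-trans (ℕ.m∸n≤m j i) j<)
        in fixed⇒0 ((ω ^ q) ^ d) p z^p≈-1 u (ω-regular (q ℕ.* i ℕ.+ k) _ _ (begin
          ω ^ (q ℕ.* i ℕ.+ k) * ((ω ^ q) ^ d * u)   ≈⟨ *-assoc _ _ _ ⟨
          ω ^ (q ℕ.* i ℕ.+ k) * (ω ^ q) ^ d * u     ≈⟨ *-congʳ (*-congˡ (^-assocʳ ω q d)) ⟩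
          ω ^ (q ℕ.* i ℕ.+ k) * ω ^ (q ℕ.* d) * u   ≈⟨ *-congʳ (^-homo-* ω (q ℕ.* i ℕ.+ k) (q ℕ.* d)) ⟨
          ω ^ (q ℕ.* i ℕ.+ k ℕ.+ q ℕ.* d) * u       ≡⟨ ≡.cong (λ e → ω ^ e * u) (translate q k (ℕ.<⇒≤ i<j)) ⟩
          ω ^ (q ℕ.* j ℕ.+ k) * u                   ≈⟨ eq ⟩
          ω ^ (q ℕ.* i ℕ.+ k) * u ∎))
        where
        d = j ℕ.∸ i

      separated : ∀ k {i j} → i ≢ j → i ℕ.< 2 ℕ.^ suc a → j ℕ.< 2 ℕ.^ suc a →
        Separated (ω ^ (q ℕ.* i ℕ.+ k)) (ω ^ (q ℕ.* j ℕ.+ k))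
      separated k {i} {j} i≢j i< j< u eq with ℕ.<-cmp i j
      ... | tri< i<j _ _ = separated-< k i j i<j j< u (sym eq)
      ... | tri≈ _ i≡j _ = contradiction i≡j i≢j
      ... | tri> _ _ j<i = separated-< k j i j<i i< u eq

      -- The rows r + t of the block contribute the common factors ω^(r (q u + k)),
      -- which are units, so the block is a Vandermonde matrix up to column scaling.
      columns-independent : ∀ {N} (u : Fin N → ℕ) k r → (∀ {i j} → i ≢ j → u i ≢ u j) →
        (∀ i → u i ℕ.< 2 ℕ.^ suc a) → (b : Vector Carrier N) →
        (∀ t → t ℕ.< N → sum (λ l → b l * ω ^ ((r ℕ.+ t) ℕ.* (q ℕ.* u l ℕ.+ k))) ≈ 0#) →
        ∀ l → b l ≈ 0#
      columns-independent u k r u-injective u< b vanish l =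
        ω-regular (x l ℕ.* r) (b l) 0# (trans (*-comm _ _) (trans
          (vandermonde (λ l → ω ^ x l) (λ l → b l * ω ^ (x l ℕ.* r))
            (λ {i} {j} i≢j → separated k (u-injective i≢j) (u< i) (u< j))
            (λ t t<N → trans (sum-cong-≋ (λ l → factor l t)) (vanish t t<N)) l)
          (sym (zeroʳ _))))
        where
        x = λ l → q ℕ.* u l ℕ.+ k
        factor : ∀ l t → b l * ω ^ (x l ℕ.* r) * (ω ^ x l) ^ t ≈ b l * ω ^ ((r ℕ.+ t) ℕ.* x l)
        factor l t = begin
          b l * ω ^ (x l ℕ.* r) * (ω ^ x l) ^ t        ≈⟨ *-assoc _ _ _ ⟩
          b l * (ω ^ (x l ℕ.* r) * (ω ^ x l) ^ t)      ≈⟨ *-congˡ (*-congˡ (^-assocʳ ω (x l) t)) ⟩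
          b l * (ω ^ (x l ℕ.* r) * ω ^ (x l ℕ.* t))    ≈⟨ *-congˡ (^-homo-* ω (x l ℕ.* r) (x l ℕ.* t)) ⟨
          b l * ω ^ (x l ℕ.* r ℕ.+ x l ℕ.* t)          ≡⟨ ≡.cong (λ e → b l * ω ^ e) (≡.trans
                                                            (≡.sym (ℕ.*-distribˡ-+ (x l) r t))
                                                            (ℕ.*-comm (x l) (r ℕ.+ t))) ⟩
          b l * ω ^ ((r ℕ.+ t) ℕ.* x l) ∎

-- Counting

-- Sending i to the position of `f i` in `xs` is an injection into `Fin (length xs)`.
injective⇒≤length : ∀ {a} {A : Set a} {n} {f : Fin n → A} {xs : List A} →
  Injective _≡_ _≡_ f → (∀ i → f i ∈ xs) → n ℕ.≤ length xs
injective⇒≤length {A = A} f-injective f∈ = Fin.injective⇒≤ λ {i} {j} eq →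
  f-injective (index-injective (≡.setoid A) (f∈ i) (f∈ j) eq)

-- A lower bound on a cardinality, kept as an injection because the members later serve as column
-- selections and as parts of the coding of altered positions.
record Family {p m} (P : Pred (Fin m) p) (a : ℕ) : Set p where
  constructor family
  field
    member    : Fin a → Fin m
    injective : Injective _≡_ _≡_ member
    satisfies : ∀ i → P (member i)

empty : ∀ {p m} {P : Pred (Fin m) p} → Family P 0
empty = family (λ ()) (λ { {()} }) λ ()

lift : ∀ {p m a} {P : Pred (Fin (suc m)) p} → Family (P ∘ suc) a → Family P a
lift (family f f-injective Pf) = family (suc ∘ f) (f-injective ∘ Fin.suc-injective) Pf

cons : ∀ {p m a} {P : Pred (Fin (suc m)) p} → P zero → Family (P ∘ suc) a → Family P (suc a)
cons {m = m} {a} {P} P0 (family f f-injective Pf) = family g g-injective Pg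
  where
  g : Fin (suc a) → Fin (suc m)
  g zero    = zero
  g (suc i) = suc (f i)
  g-injective : Injective _≡_ _≡_ g
  g-injective {zero}  {zero}  _  = ≡.refl
  g-injective {suc i} {suc j} eq = ≡.cong suc (f-injective (Fin.suc-injective eq))
  Pg : ∀ i → P (g i)
  Pg zero    = P0
  Pg (suc i) = Pf i

-- Induction on m: index zero joins one of the two families and lowers the corresponding target by
-- one, as it lowers m.
pigeonhole : ∀ {p m} {P : Pred (Fin m) p} → Decidable P → ∀ a b → a ℕ.+ b ℕ.≤ suc m →
  Family P a ⊎ Family (¬_ ∘ P) b
pigeonhole P? zero b _ = inj₁ empty
pigeonhole P? (suc a) zero _ = inj₂ empty
pigeonhole {m = zero} P? (suc a) (suc b) (s≤s a+1+b≤0)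
  rewrite ℕ.+-suc a b with () ← a+1+b≤0
pigeonhole {m = suc m} P? (suc a) (suc b) (s≤s a+1+b≤1+m) with P? zero
... | yes P0 with pigeonhole (P? ∘ suc) a (suc b) a+1+b≤1+m
...   | inj₁ F = inj₁ (cons P0 F)
...   | inj₂ F = inj₂ (lift F)
pigeonhole {m = suc m} P? (suc a) (suc b) (s≤s a+1+b≤1+m) | no ¬P0
  with pigeonhole (P? ∘ suc) (suc a) b (≡.subst (ℕ._≤ suc m) (ℕ.+-suc a b) a+1+b≤1+m)
...   | inj₁ F = inj₁ (lift F)
...   | inj₂ F = inj₂ (cons ¬P0 F)

-- The Cauchy product of exponential series

module CauchyProduct {r ℓ} (R : CommutativeRing r ℓ) where
  open CommutativeRing R hiding (zero)
  open import Algebra.Properties.Semiring.Mult semiring renaming (_×_ to infixr 8 _⋆_)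
  open import Algebra.Properties.CommutativeMonoid.Mult +-commutativeMonoid using (×-distrib-+)
  open import Algebra.Properties.CommutativeSemigroup +-commutativeSemigroup using (interchange; xy∙z≈xz∙y)
  open import Algebra.Properties.CommutativeSemigroup *-commutativeSemigroup using (x∙yz≈y∙xz)
  open import Relation.Binary.Reasoning.Setoid setoid

  -- A product rule with degrees as weights: multiplying a term of degree m + n by its degree splits
  -- into the recurrences of its two factors.
  ⋆-*-leibniz : ∀ m n x y → (m ℕ.+ n) ⋆ (x * y) ≈ (m ⋆ x) * y + x * (n ⋆ y)
  ⋆-*-leibniz m n x y = trans (×-homo-+ (x * y) m n)
    (+-cong (sym (×-assoc-* m x y)) (trans (×-congʳ n (*-comm x y))
      (trans (sym (×-assoc-* n y x)) (*-comm _ _))))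

  partialSum : (ℕ → Carrier) → ℕ → Carrier
  partialSum t zero    = t 0
  partialSum t (suc n) = partialSum t n + t (suc n)

  module _ (s t : ℕ → Carrier) where

    -- antidiagonal a b = Σ_{i<a} sᵢ t_{a+b-1-i}
    antidiagonal : ℕ → ℕ → Carrier
    antidiagonal zero    b = 0#
    antidiagonal (suc a) b = antidiagonal a (suc b) + s a * t b

  module _ (s t : ℕ → Carrier) where

    -- Raising b by one lengthens every inner partial sum by exactly one term, and these new terms
    -- form an antidiagonal of t.
    antidiagonal-partialSum : ∀ a b →
      antidiagonal s (partialSum t) a (suc b) ≈ antidiagonal s (partialSum t) a b + antidiagonal s t a (suc b)
    antidiagonal-partialSum zero    b = sym (+-identityˡ 0#)
    antidiagonal-partialSum (suc a) b =
      trans (+-cong (antidiagonal-partialSum a (suc b)) (distribˡ _ _ _)) (interchange _ _ _ _)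

    -- Both sides sum sᵢ tⱼ over the triangle i + j ≤ n, once by i and once by total degree.
    triangle : ∀ n → antidiagonal s (partialSum t) (suc n) 0 ≈
      partialSum (λ k → antidiagonal s t (suc k) 0) n
    triangle zero    = refl
    triangle (suc n) = begin
      antidiagonal s (partialSum t) (suc n) 1 + s (suc n) * t 0
        ≈⟨ +-congʳ (antidiagonal-partialSum (suc n) 0) ⟩
      antidiagonal s (partialSum t) (suc n) 0 + antidiagonal s t (suc n) 1 + s (suc n) * t 0
        ≈⟨ +-assoc _ _ _ ⟩
      antidiagonal s (partialSum t) (suc n) 0 + antidiagonal s t (suc (suc n)) 0
        ≈⟨ +-congʳ (triangle n) ⟩
      partialSum (λ k → antidiagonal s t (suc k) 0) (suc n) ∎

  -- t k plays the role of gᵏ / k!.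
  record IsExponential (g : Carrier) (t : ℕ → Carrier) : Set ℓ where
    constructor is-exponential
    field
      recurrence : ∀ k → suc k ⋆ t (suc k) ≈ g * t k

  module _ {g h : Carrier} {s t : ℕ → Carrier} 
    (s-exponential : IsExponential g s) (t-exponential : IsExponential h t) where
    open IsExponential s-exponential renaming (recurrence to s-exp)
    open IsExponential t-exponential renaming (recurrence to t-exp)
    private c = antidiagonal s t

    -- The product rule on a truncated antidiagonal, the form that admits induction on a.
    -- Differentiating the factors from s lowers a, differentiating those from t lowers b.
    antidiagonal-step : ∀ a b →
      (suc a ℕ.+ b) ⋆ c (suc a) (suc b) ≈ g * c a (suc b) + h * c (suc a) b
    antidiagonal-step zero b = begin
      suc b ⋆ (0# + s 0 * t (suc b))       ≈⟨ ×-congʳ (suc b) (+-identityˡ _) ⟩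
      suc b ⋆ (s 0 * t (suc b))            ≈⟨ ⋆-*-leibniz 0 (suc b) _ _ ⟩
      0# * t (suc b) + s 0 * (suc b ⋆ t (suc b))
                                           ≈⟨ +-cong (trans (zeroˡ _) (sym (zeroʳ g))) (*-congˡ (t-exp b)) ⟩
      g * 0# + s 0 * (h * t b)             ≈⟨ +-congˡ (x∙yz≈y∙xz _ _ _) ⟩
      g * 0# + h * (s 0 * t b)             ≈⟨ +-congˡ (*-congˡ (+-identityˡ _)) ⟨
      g * 0# + h * (0# + s 0 * t b) ∎
    antidiagonal-step (suc a) b = begin
      (suc (suc a) ℕ.+ b) ⋆ (c (suc a) (suc (suc b)) + s (suc a) * t (suc b))
        ≡⟨ ≡.cong (λ n → n ⋆ c (suc (suc a)) (suc b)) (≡.sym (ℕ.+-suc (suc a) b)) ⟩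
      (suc a ℕ.+ suc b) ⋆ (c (suc a) (suc (suc b)) + s (suc a) * t (suc b))
        ≈⟨ ×-distrib-+ _ _ (suc a ℕ.+ suc b) ⟩
      (suc a ℕ.+ suc b) ⋆ c (suc a) (suc (suc b)) + (suc a ℕ.+ suc b) ⋆ (s (suc a) * t (suc b))
        ≈⟨ +-cong (antidiagonal-step a (suc b)) (⋆-*-leibniz (suc a) (suc b) _ _) ⟩
      (g * c a (suc (suc b)) + h * c (suc a) (suc b)) +
        ((suc a ⋆ s (suc a)) * t (suc b) + s (suc a) * (suc b ⋆ t (suc b)))
        ≈⟨ +-congˡ (+-cong (trans (*-congʳ (s-exp a)) (*-assoc _ _ _))
                           (trans (*-congˡ (t-exp b)) (x∙yz≈y∙xz _ _ _))) ⟩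
      (g * c a (suc (suc b)) + h * c (suc a) (suc b)) +
        (g * (s a * t (suc b)) + h * (s (suc a) * t b))
        ≈⟨ interchange _ _ _ _ ⟩
      (g * c a (suc (suc b)) + g * (s a * t (suc b))) +
        (h * c (suc a) (suc b) + h * (s (suc a) * t b))
        ≈⟨ +-cong (distribˡ _ _ _) (distribˡ _ _ _) ⟨
      g * c (suc a) (suc b) + h * c (suc (suc a)) b ∎

    -- The binomial theorem for (g + h)ᵏ / k!, obtained from the recurrence without binomial
    -- coefficients.
    antidiagonal-exponential : IsExponential (g + h) (λ k → c (suc k) 0)
    antidiagonal-exponential = is-exponential λ k → begin
      -- The last term is split off: its factor `t 0` has degree zero and contributes only through
      -- s.
      suc k ⋆ (c (suc k) 1 + s (suc k) * t 0)
        ≈⟨ ×-distrib-+ _ _ (suc k) ⟩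
      suc k ⋆ c (suc k) 1 + suc k ⋆ (s (suc k) * t 0)
        ≈⟨ +-cong (≡.subst (λ n → n ⋆ c (suc k) 1 ≈ g * c k 1 + h * c (suc k) 0)
                     (ℕ.+-identityʳ (suc k)) (antidiagonal-step k 0))
                  (sym (×-assoc-* (suc k) _ _)) ⟩
      (g * c k 1 + h * c (suc k) 0) + (suc k ⋆ s (suc k)) * t 0
        ≈⟨ +-congˡ (trans (*-congʳ (s-exp k)) (*-assoc _ _ _)) ⟩
      (g * c k 1 + h * c (suc k) 0) + g * (s k * t 0)
        ≈⟨ xy∙z≈xz∙y _ _ _ ⟩
      (g * c k 1 + g * (s k * t 0)) + h * c (suc k) 0
        ≈⟨ +-congʳ (distribˡ _ _ _) ⟨
      g * c (suc k) 0 + h * c (suc k) 0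
        ≈⟨ distribʳ _ _ _ ⟨
      (g + h) * c (suc k) 0 ∎

-- The ring of complex numbers

module ComplexNumbers where
  open import Data.Rational.Base using (_≤_; _<_; _/_)
  open import Defs

  module GaussianLaws where
    open +-*-Solver using (solve; _:=_; _:+_; _:*_; _:-_; :-_; con)

    private
      re-assoc : ∀ a b c d e f → (a ℚ.* c ℚ.- b ℚ.* d) ℚ.* e ℚ.- (a ℚ.* d ℚ.+ b ℚ.* c) ℚ.* f ≡
        a ℚ.* (c ℚ.* e ℚ.- d ℚ.* f) ℚ.- b ℚ.* (c ℚ.* f ℚ.+ d ℚ.* e)
      re-assoc = solve 6 (λ a b c d e f → (a :* c :- b :* d) :* e :- (a :* d :+ b :* c) :* f :=
        a :* (c :* e :- d :* f) :- b :* (c :* f :+ d :* e)) ≡.refl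

      im-assoc : ∀ a b c d e f → (a ℚ.* c ℚ.- b ℚ.* d) ℚ.* f ℚ.+ (a ℚ.* d ℚ.+ b ℚ.* c) ℚ.* e ≡
        a ℚ.* (c ℚ.* f ℚ.+ d ℚ.* e) ℚ.+ b ℚ.* (c ℚ.* e ℚ.- d ℚ.* f)
      im-assoc = solve 6 (λ a b c d e f → (a :* c :- b :* d) :* f :+ (a :* d :+ b :* c) :* e :=
        a :* (c :* f :+ d :* e) :+ b :* (c :* e :- d :* f)) ≡.refl

      re-distrib : ∀ a b c d e f → a ℚ.* (c ℚ.+ e) ℚ.- b ℚ.* (d ℚ.+ f) ≡
        (a ℚ.* c ℚ.- b ℚ.* d) ℚ.+ (a ℚ.* e ℚ.- b ℚ.* f)
      re-distrib = solve 6 (λ a b c d e f → a :* (c :+ e) :- b :* (d :+ f) :=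
        (a :* c :- b :* d) :+ (a :* e :- b :* f)) ≡.refl

      im-distrib : ∀ a b c d e f → a ℚ.* (d ℚ.+ f) ℚ.+ b ℚ.* (c ℚ.+ e) ≡
        (a ℚ.* d ℚ.+ b ℚ.* c) ℚ.+ (a ℚ.* f ℚ.+ b ℚ.* e)
      im-distrib = solve 6 (λ a b c d e f → a :* (d :+ f) :+ b :* (c :+ e) :=
        (a :* d :+ b :* c) :+ (a :* f :+ b :* e)) ≡.refl

      re-comm : ∀ a b c d → a ℚ.* c ℚ.- b ℚ.* d ≡ c ℚ.* a ℚ.- d ℚ.* b
      re-comm = solve 4 (λ a b c d → a :* c :- b :* d := c :* a :- d :* b) ≡.refl

      im-comm : ∀ a b c d → a ℚ.* d ℚ.+ b ℚ.* c ≡ c ℚ.* b ℚ.+ d ℚ.* a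
      im-comm = solve 4 (λ a b c d → a :* d :+ b :* c := c :* b :+ d :* a) ≡.refl

      re-identity : ∀ a b → 1ℚ ℚ.* a ℚ.- 0ℚ ℚ.* b ≡ a
      re-identity = solve 2 (λ a b → con 1ℚ :* a :- con 0ℚ :* b := a) ≡.refl

      im-identity : ∀ a b → 1ℚ ℚ.* b ℚ.+ 0ℚ ℚ.* a ≡ b
      im-identity = solve 2 (λ a b → con 1ℚ :* b :+ con 0ℚ :* a := b) ≡.refl

    +-assoc : ∀ f g h → (f +ᵍ g) +ᵍ h ≡ f +ᵍ (g +ᵍ h)
    +-assoc (a +i b) (c +i d) (e +i f) = ≡.cong₂ _+i_ (ℚ.+-assoc a c e) (ℚ.+-assoc b d f)

    +-comm : ∀ g h → g +ᵍ h ≡ h +ᵍ g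
    +-comm (a +i b) (c +i d) = ≡.cong₂ _+i_ (ℚ.+-comm a c) (ℚ.+-comm b d)

    +-identityˡ : ∀ g → 0ᵍ +ᵍ g ≡ g
    +-identityˡ (a +i b) = ≡.cong₂ _+i_ (ℚ.+-identityˡ a) (ℚ.+-identityˡ b)

    -‿inverseˡ : ∀ g → -ᵍ g +ᵍ g ≡ 0ᵍ
    -‿inverseˡ (a +i b) = ≡.cong₂ _+i_ (ℚ.+-inverseˡ a) (ℚ.+-inverseˡ b)

    *-assoc : ∀ f g h → (f *ᵍ g) *ᵍ h ≡ f *ᵍ (g *ᵍ h)
    *-assoc (a +i b) (c +i d) (e +i f) = ≡.cong₂ _+i_ (re-assoc a b c d e f) (im-assoc a b c d e f)

    *-comm : ∀ g h → g *ᵍ h ≡ h *ᵍ g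
    *-comm (a +i b) (c +i d) = ≡.cong₂ _+i_ (re-comm a b c d) (im-comm a b c d)

    *-identityˡ : ∀ g → 1ᵍ *ᵍ g ≡ g
    *-identityˡ (a +i b) = ≡.cong₂ _+i_ (re-identity a b) (im-identity a b)

    *-distribˡ-+ : ∀ f g h → f *ᵍ (g +ᵍ h) ≡ f *ᵍ g +ᵍ f *ᵍ h
    *-distribˡ-+ (a +i b) (c +i d) (e +i f) =
      ≡.cong₂ _+i_ (re-distrib a b c d e f) (im-distrib a b c d e f)

  -- Commutativity supplies the right-hand laws. The carrier is abstract, so that both ℚ(i) and ℂ
  -- can use it.
  isCommutativeRing-fromˡ : {A : Set} (_≈ᴬ_ : A → A → Set) (equiv : IsEquivalence _≈ᴬ_)
    (_+ᴬ_ _*ᴬ_ : A → A → A) (-ᴬ_ : A → A) (0ᴬ 1ᴬ : A)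
    (+-cong : ∀ {x y u v} → x ≈ᴬ y → u ≈ᴬ v → (x +ᴬ u) ≈ᴬ (y +ᴬ v))
    (*-cong : ∀ {x y u v} → x ≈ᴬ y → u ≈ᴬ v → (x *ᴬ u) ≈ᴬ (y *ᴬ v))
    (-‿cong : ∀ {x y} → x ≈ᴬ y → (-ᴬ x) ≈ᴬ (-ᴬ y))
    (+-assoc : ∀ x y z → ((x +ᴬ y) +ᴬ z) ≈ᴬ (x +ᴬ (y +ᴬ z)))
    (+-comm : ∀ x y → (x +ᴬ y) ≈ᴬ (y +ᴬ x))
    (+-identityˡ : ∀ x → (0ᴬ +ᴬ x) ≈ᴬ x)
    (-‿inverseˡ : ∀ x → ((-ᴬ x) +ᴬ x) ≈ᴬ 0ᴬ)
    (*-assoc : ∀ x y z → ((x *ᴬ y) *ᴬ z) ≈ᴬ (x *ᴬ (y *ᴬ z)))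
    (*-comm : ∀ x y → (x *ᴬ y) ≈ᴬ (y *ᴬ x))
    (*-identityˡ : ∀ x → (1ᴬ *ᴬ x) ≈ᴬ x)
    (*-distribˡ-+ : ∀ x y z → (x *ᴬ (y +ᴬ z)) ≈ᴬ ((x *ᴬ y) +ᴬ (x *ᴬ z))) →
    IsCommutativeRing _≈ᴬ_ _+ᴬ_ _*ᴬ_ -ᴬ_ 0ᴬ 1ᴬ
  isCommutativeRing-fromˡ {A} _≈ᴬ_ equiv _+ᴬ_ _*ᴬ_ -ᴬ_ 0ᴬ 1ᴬ +-cong *-cong -‿cong +-assoc +-comm +-identityˡ -‿inverseˡ
    *-assoc *-comm *-identityˡ *-distribˡ-+ = record
    { isRing = record
      { +-isAbelianGroup = record
        { isGroup = record
          { isMonoid = record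
            { isSemigroup = record
              { isMagma = record { isEquivalence = equiv ; ∙-cong = +-cong }
              ; assoc = +-assoc }
            ; identity = +-identityˡ , λ x → trans (+-comm x 0ᴬ) (+-identityˡ x) }
          ; inverse = -‿inverseˡ , λ x → trans (+-comm x (-ᴬ x)) (-‿inverseˡ x)
          ; ⁻¹-cong = -‿cong }
        ; comm = +-comm }
      ; *-cong = *-cong
      ; *-assoc = *-assoc
      ; *-identity = *-identityˡ , λ x → trans (*-comm x 1ᴬ) (*-identityˡ x)
      ; distrib = *-distribˡ-+ , λ x y z → trans (*-comm (y +ᴬ z) x)
          (trans (*-distribˡ-+ x y z) (+-cong (*-comm x y) (*-comm x z))) }
    ; *-comm = *-comm }
    where open IsEquivalence equiv using (trans)

  ℚ[i]-commutativeRing : CommutativeRing 0ℓ 0ℓ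
  ℚ[i]-commutativeRing = record { isCommutativeRing = isCommutativeRing-fromˡ _≡_ ≡.isEquivalence _+ᵍ_ _*ᵍ_ (λ g → -ᵍ g) 0ᵍ 1ᵍ
    (≡.cong₂ _+ᵍ_) (≡.cong₂ _*ᵍ_) (≡.cong λ g → -ᵍ g)
    GaussianLaws.+-assoc GaussianLaws.+-comm GaussianLaws.+-identityˡ GaussianLaws.-‿inverseˡ
    GaussianLaws.*-assoc GaussianLaws.*-comm GaussianLaws.*-identityˡ GaussianLaws.*-distribˡ-+ }

  module Gaussian where
    open CommutativeRing ℚ[i]-commutativeRing public
    open import Algebra.Properties.Ring ring public
    open import Algebra.Properties.CommutativeSemigroup +-commutativeSemigroup public using (interchange)

  double : ∀ x → x ℚ.+ x ≡ ι 2 ℚ.* x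
  double = let open +-*-Solver in solve 1 (λ x → x :+ x := con (ι 2) :* x) ≡.refl

  -- Null sequences, and congruence of the operations on ℂ

  record Null (f : ℕ → ℚ[i]) : Set where
    constructor is-null
    field
      modulus : ∀ ε → 0ℚ < ε → ∃[ N ] ∀ n → N ℕ.≤ n → ‖ f n ‖ ≤ ε

  open Null

  null-≤ : ∀ {f g} → (∀ n → ‖ g n ‖ ≤ ‖ f n ‖) → Null f → Null g
  null-≤ g≤f f-null = is-null λ ε 0<ε → let N , p = modulus f-null ε 0<ε in
    N , λ n N≤n → ℚ.≤-trans (g≤f n) (p n N≤n)

  null-≗ : ∀ {f g} → (∀ n → f n ≡ g n) → Null f → Null g
  null-≗ f≗g = null-≤ λ n → ℚ.≤-reflexive (≡.cong ‖_‖ (≡.sym (f≗g n)))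

  null-neg : ∀ {f} → Null f → Null (λ n → -ᵍ f n)
  null-neg {f} = null-≤ λ n → ℚ.≤-reflexive (‖-‖ (f n))

  null-+ : ∀ {f g} → Null f → Null g → Null (λ n → f n +ᵍ g n)
  null-+ {f} {g} f-null g-null = is-null (rescale (ι 2) (from-yes (0ℚ ℚ.<? ι 2)) λ ε 0<ε →
    let M , p = modulus f-null ε 0<ε
        N , q = modulus g-null ε 0<ε
    in M ℕ.⊔ N , λ n ≤n → ℚ.≤-trans (‖+‖ (f n) (g n)) (ℚ.≤-trans
      (ℚ.+-mono-≤ (p n (ℕ.m⊔n≤o⇒m≤o M N ≤n)) (q n (ℕ.m⊔n≤o⇒n≤o M N ≤n)))
      (ℚ.≤-reflexive (double ε))))

  -- A Cauchy sequence is bounded by some B, so `f` below ε puts the product below B ε.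
  null-* : ∀ {f g} → Null f → IsCauchy g → Null (λ n → f n *ᵍ g n)
  null-* {f} {g} f-null g-cauchy = let B , 0<B , g≤B = cauchy-bounded g-cauchy in
    is-null (rescale B 0<B λ ε 0<ε → let N , p = modulus f-null ε 0<ε in
      N , λ n N≤n → ℚ.≤-trans (‖*‖ (f n) (g n)) (ℚ.≤-trans
        (*-mono-≤ (0≤‖‖ (f n)) (p n N≤n) (0≤‖‖ (g n)) (g≤B n))
        (ℚ.≤-reflexive (ℚ.*-comm ε B))))

  ≈⇒null : ∀ {x y} → x ≈ y → Null (λ n → seq x n -ᵍ seq y n)
  ≈⇒null (mk≈ p) = is-null p

  null⇒≈ : ∀ {x y} → Null (λ n → seq x n -ᵍ seq y n) → x ≈ y
  null⇒≈ (is-null p) = mk≈ p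

  ≗⇒≈ : ∀ {x y} → (∀ n → seq x n ≡ seq y n) → x ≈ y
  ≗⇒≈ {x} {y} x≗y = mk≈ λ ε 0<ε → 0 , λ n _ →
    ≡.subst (_≤ ε) (≡.sym (≡.cong ‖_‖ (≡.trans (≡.cong (_-ᵍ seq y n) (x≗y n)) (g-g (seq y n))))) (ℚ.<⇒≤ 0<ε)

  ≈-isEquivalence : IsEquivalence _≈_
  ≈-isEquivalence = record
    { refl  = ≗⇒≈ λ _ → ≡.refl
    ; sym   = λ {x} {y} x≈y → null⇒≈ (null-≤ (λ n → ℚ.≤-reflexive (‖-‖-sym (seq y n) (seq x n))) (≈⇒null x≈y))
    ; trans = λ {x} {y} {z} x≈y y≈z → null⇒≈ (null-≗ (λ n → chain (seq x n) (seq y n) (seq z n))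
        (null-+ (≈⇒null x≈y) (≈⇒null y≈z)))
    }
    where
    chain : ∀ f g h → (f -ᵍ g) +ᵍ (g -ᵍ h) ≡ f -ᵍ h
    chain f g h = ≡.trans (Gaussian.+-assoc f (-ᵍ g) (g -ᵍ h)) (≡.cong (f +ᵍ_)
      (≡.trans (≡.sym (Gaussian.+-assoc (-ᵍ g) g (-ᵍ h)))
        (≡.trans (≡.cong (_+ᵍ -ᵍ h) (Gaussian.-‿inverseˡ g)) (Gaussian.+-identityˡ (-ᵍ h)))))

  +ᶜ-cong : ∀ {x y u v} → x ≈ y → u ≈ v → x +ᶜ u ≈ y +ᶜ v
  +ᶜ-cong {x} {y} {u} {v} x≈y u≈v = null⇒≈ (null-≗
    (λ n → ≡.trans (Gaussian.interchange (seq x n) (-ᵍ seq y n) (seq u n) (-ᵍ seq v n))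
      (≡.cong ((seq x n +ᵍ seq u n) +ᵍ_) (Gaussian.-‿+-comm (seq y n) (seq v n))))
    (null-+ (≈⇒null x≈y) (≈⇒null u≈v)))

  -ᶜ-cong : ∀ {x y} → x ≈ y → -ᶜ x ≈ -ᶜ y
  -ᶜ-cong {x} {y} x≈y = null⇒≈ (null-≗
    (λ n → ≡.sym (Gaussian.-‿+-comm (seq x n) (-ᵍ seq y n))) (null-neg (≈⇒null x≈y)))

  -- From x u - y v = x (u - v) + (x - y) v, a sum of two products of a null and a Cauchy sequence.
  *ᶜ-cong : ∀ {x y u v} → x ≈ y → u ≈ v → x *ᶜ u ≈ y *ᶜ v
  *ᶜ-cong {x} {y} {u} {v} x≈y u≈v = null⇒≈ (null-≗
    (λ n → ≡.trans (≡.cong (_+ᵍ _) (Gaussian.*-comm (seq u n -ᵍ seq v n) (seq x n)))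
      (≡.sym (*ᵍ-difference (seq x n) (seq u n) (seq y n) (seq v n))))
    (null-+ (null-* (≈⇒null u≈v) (cauchy x)) (null-* (≈⇒null x≈y) (cauchy v))))

  -- Comparing two unfolded complex numbers makes Agda compare their Cauchy moduli,
  -- which are huge; the opaque copies of the operations keep it from doing so.
  infixl 6 _⊕_
  infixl 7 _⊗_
  infix  8 ⊖_

  opaque
    _⊕_ _⊗_ : ℂ → ℂ → ℂ
    _⊕_ = _+ᶜ_
    _⊗_ = _*ᶜ_

    ⊖_ : ℂ → ℂ
    ⊖ x = -ᶜ x

    ⊕≈+ᶜ : ∀ x y → x ⊕ y ≈ x +ᶜ y
    ⊕≈+ᶜ x y = ≗⇒≈ λ _ → ≡.refl

    ⊗≈*ᶜ : ∀ x y → x ⊗ y ≈ x *ᶜ y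
    ⊗≈*ᶜ x y = ≗⇒≈ λ _ → ≡.refl

    ⊖≈-ᶜ : ∀ x → ⊖ x ≈ -ᶜ x
    ⊖≈-ᶜ x = ≗⇒≈ λ _ → ≡.refl

    ⊕-⊗-isCommutativeRing : IsCommutativeRing _≈_ _⊕_ _⊗_ ⊖_ 0ᶜ 1ᶜ
    ⊕-⊗-isCommutativeRing = isCommutativeRing-fromˡ _≈_ ≈-isEquivalence _+ᶜ_ _*ᶜ_ (λ x → -ᶜ x) 0ᶜ 1ᶜ
      +ᶜ-cong *ᶜ-cong -ᶜ-cong
      (λ x y z → ≗⇒≈ λ n → Gaussian.+-assoc (seq x n) (seq y n) (seq z n))
      (λ x y → ≗⇒≈ λ n → Gaussian.+-comm (seq x n) (seq y n))
      (λ x → ≗⇒≈ λ n → Gaussian.+-identityˡ (seq x n))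
      (λ x → ≗⇒≈ λ n → Gaussian.-‿inverseˡ (seq x n))
      (λ x y z → ≗⇒≈ λ n → Gaussian.*-assoc (seq x n) (seq y n) (seq z n))
      (λ x y → ≗⇒≈ λ n → Gaussian.*-comm (seq x n) (seq y n))
      (λ x → ≗⇒≈ λ n → Gaussian.*-identityˡ (seq x n))
      (λ x y z → ≗⇒≈ λ n → Gaussian.distribˡ (seq x n) (seq y n) (seq z n))

  ℂ-commutativeRing : CommutativeRing 0ℓ 0ℓ
  ℂ-commutativeRing = record { isCommutativeRing = ⊕-⊗-isCommutativeRing }

  module ℂᵣ where
    open CommutativeRing ℂ-commutativeRing public hiding (_≈_; zero)
    open import Algebra.Properties.Ring ring public
    open import Algebra.Properties.CommutativeSemiring.Exp commutativeSemiring public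
    open import Algebra.Properties.Semiring.Sum semiring public using (sum)

  -- The exponential is additive

  open CauchyProduct ℚ[i]-commutativeRing
  open SemiringMult Gaussian.semiring using () renaming (_×_ to infixr 8 _⋆_)

  ·-cancel : ∀ k g → (+ 1 / suc k) · (ι (suc k) · g) ≡ g
  ·-cancel k (a +i b) = ≡.cong₂ _+i_ (cancel a) (cancel b)
    where
    cancel : ∀ x → (+ 1 / suc k) ℚ.* (ι (suc k) ℚ.* x) ≡ x
    cancel x = ≡.trans (≡.sym (ℚ.*-assoc (+ 1 / suc k) (ι (suc k)) x))
      (≡.trans (≡.cong (ℚ._* x) (suc-inverse k)) (ℚ.*-identityˡ x))

  ·-comm : ∀ p q g → p · (q · g) ≡ q · (p · g)
  ·-comm p q (a +i b) = ≡.cong₂ _+i_ (comm a) (comm b)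
    where
    comm : ∀ x → p ℚ.* (q ℚ.* x) ≡ q ℚ.* (p ℚ.* x)
    comm x = ≡.trans (≡.sym (ℚ.*-assoc p q x))
      (≡.trans (≡.cong (ℚ._* x) (ℚ.*-comm p q)) (ℚ.*-assoc q p x))

  ⋆≡· : ∀ n g → n ⋆ g ≡ ι n · g
  ⋆≡· zero    (a +i b) = ≡.cong₂ _+i_ (≡.sym (ℚ.*-zeroˡ a)) (≡.sym (ℚ.*-zeroˡ b))
  ⋆≡· (suc n) g@(a +i b) = ≡.trans (≡.cong (g +ᵍ_) (⋆≡· n g)) (≡.cong₂ _+i_ (step a) (step b))
    where
    step : ∀ x → x ℚ.+ ι n ℚ.* x ≡ ι (suc n) ℚ.* x
    step x = ≡.trans (≡.cong (ℚ._+ ι n ℚ.* x) (≡.sym (ℚ.*-identityˡ x)))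
      (≡.trans (≡.sym (ℚ.*-distribʳ-+ x 1ℚ (ι n))) (≡.cong (ℚ._* x) (≡.sym (ι-suc n))))

  expTerm-exponential : ∀ g → IsExponential g (expTerm g)
  expTerm-exponential g = is-exponential λ k → ≡.trans (⋆≡· (suc k) (expTerm g (suc k)))
    (≡.trans (·-comm (ι (suc k)) (+ 1 / suc k) (g *ᵍ expTerm g k)) (·-cancel k (g *ᵍ expTerm g k)))

  -- In ℚ(i) one can divide by k + 1, so the recurrence determines the whole sequence from its value
  -- at 0.
  exponential-unique : ∀ {g s} → s 0 ≡ 1ᵍ → IsExponential g s → ∀ k → s k ≡ expTerm g k
  exponential-unique s0 s-exp zero    = s0
  exponential-unique {g} {s} s0 s-exp (suc k) = ≡.trans (≡.sym (·-cancel k (s (suc k))))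
    (≡.cong ((+ 1 / suc k) ·_) (≡.trans (≡.sym (⋆≡· (suc k) (s (suc k))))
      (≡.trans (IsExponential.recurrence s-exp k) (≡.cong (g *ᵍ_) (exponential-unique s0 s-exp k)))))

  partialSum-expTerm : ∀ {g s} → (∀ k → s k ≡ expTerm g k) → ∀ N → partialSum s N ≡ expSum N g
  partialSum-expTerm s≗ zero    = s≗ 0
  partialSum-expTerm s≗ (suc N) = ≡.cong₂ _+ᵍ_ (partialSum-expTerm s≗ N) (s≗ (suc N))

  -- The part i + j ≤ N of the product of two partial sums is regrouped by degree; uniqueness
  -- identifies each degree with a term of the series for g + h.
  expSum-triangle : ∀ g h N →
    antidiagonal (expTerm g) (λ b → expSum b h) (suc N) 0 ≡ expSum N (g +ᵍ h)
  expSum-triangle g h N = ≡.trans (antidiagonal-cong (λ b → ≡.sym (partialSum-expTerm (λ _ → ≡.refl) b)) (suc N) 0)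
    (≡.trans (triangle (expTerm g) (expTerm h) N)
      (partialSum-expTerm (exponential-unique ≡.refl
        (antidiagonal-exponential (expTerm-exponential g) (expTerm-exponential h))) N))
    where
    antidiagonal-cong : ∀ {s t t′} → (∀ b → t b ≡ t′ b) → ∀ a b → antidiagonal s t a b ≡ antidiagonal s t′ a b
    antidiagonal-cong t≗ zero    b = ≡.refl
    antidiagonal-cong {s} t≗ (suc a) b = ≡.cong₂ _+ᵍ_ (antidiagonal-cong t≗ a (suc b)) (≡.cong (s a *ᵍ_) (t≗ b))

  -- Error of a product of partial sums

  half^ : ℕ → ℚ
  half^ zero    = 1ℚ
  half^ (suc k) = ½ ℚ.* half^ k

  0≤half^ : ∀ k → 0ℚ ≤ half^ k
  0≤half^ zero    = from-yes (0ℚ ℚ.≤? 1ℚ)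
  0≤half^ (suc k) = 0≤* {½} {half^ k} (from-yes (0ℚ ℚ.≤? ½)) (0≤half^ k)

  half^≤1 : ∀ k → half^ k ≤ 1ℚ
  half^≤1 zero    = ℚ.≤-refl
  half^≤1 (suc k) = *-mono-≤ {½} {1ℚ} {half^ k} {1ℚ} (from-yes (0ℚ ℚ.≤? ½)) (from-yes (½ ℚ.≤? 1ℚ))
    (0≤half^ k) (half^≤1 k)

  half^-+ : ∀ a b → half^ (a ℕ.+ b) ≡ half^ a ℚ.* half^ b
  half^-+ zero    b = ≡.sym (ℚ.*-identityˡ (half^ b))
  half^-+ (suc a) b = ≡.trans (≡.cong (½ ℚ.*_) (half^-+ a b)) (≡.sym (ℚ.*-assoc ½ (half^ a) (half^ b)))

  half^-antitone : ∀ a b → half^ (a ℕ.+ b) ≤ half^ b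
  half^-antitone a b = ≡.subst₂ _≤_ (≡.sym (half^-+ a b)) (ℚ.*-identityˡ (half^ b))
    (*-monoʳ {half^ b} (0≤half^ b) (half^≤1 a))

  half^-small : ∀ ε → 0ℚ < ε → ∃[ N ] ∀ n → N ℕ.≤ n → half^ n ≤ ε
  half^-small ε 0<ε = let j , p = small ε 0<ε in j ℕ.+ 0 , λ n j≤n →
    ℚ.≤-trans (≡.subst (λ l → half^ l ≤ half^ (j ℕ.+ 0)) (ℕ.m∸n+n≡m j≤n) (half^-antitone (n ℕ.∸ (j ℕ.+ 0)) (j ℕ.+ 0))) p
    where
    open +-*-Solver
    2*½ : ∀ x → ι 2 ℚ.* (½ ℚ.* x) ≡ x
    2*½ = solve 1 (λ x → con (ι 2) :* (con ½ :* x) := x) ≡.refl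
    open Halving {half^} 0 0≤half^ (λ k _ → ℚ.≤-reflexive (2*½ (half^ k)))

  private
    module _ where
      open +-*-Solver

      half-out : ∀ c B h m → c ℚ.* (B ℚ.* (h ℚ.* m)) ≡ (½ ℚ.* h) ℚ.* (c ℚ.* ((ι 2 ℚ.* B) ℚ.* m))
      half-out = solve 4 (λ c B h m →
        c :* (B :* (h :* m)) := (con ½ :* h) :* (c :* ((con (ι 2) :* B) :* m))) ≡.refl

      product-out : ∀ h m h′ C → (h ℚ.* m) ℚ.* (h′ ℚ.* C) ≡ (h ℚ.* h′) ℚ.* (C ℚ.* m)
      product-out = solve 4 (λ h m h′ C → (h :* m) :* (h′ :* C) := (h :* h′) :* (C :* m)) ≡.refl

      cancel-left : ∀ x y → (x ℚ.+ y) ℚ.- x ≡ y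
      cancel-left = solve 2 (λ x y → (x :+ y) :- x := y) ≡.refl

      add-sub : ∀ x y z → (x ℚ.+ y) ℚ.- z ≡ y ℚ.+ (x ℚ.- z)
      add-sub = solve 3 (λ x y z → (x :+ y) :- z := y :+ (x :- z)) ≡.refl

      factor-out : ∀ h C M m → h ℚ.* (C ℚ.* M) ℚ.+ h ℚ.* (C ℚ.* m) ≡ h ℚ.* (C ℚ.* (M ℚ.+ m))
      factor-out = solve 4 (λ h C M m → h :* (C :* M) :+ h :* (C :* m) := h :* (C :* (M :+ m))) ≡.refl

  -- Doubling the radius frees a geometric factor 2⁻ᵏ, the source of all decay in the error estimate
  -- below.
  majorant-half : ∀ B k → majorant B k ≡ half^ k ℚ.* majorant (ι 2 ℚ.* B) k
  majorant-half B zero    = ≡.refl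
  majorant-half B (suc k) = ≡.trans (≡.cong (λ m → (+ 1 / suc k) ℚ.* (B ℚ.* m)) (majorant-half B k))
    (half-out (+ 1 / suc k) B (half^ k) (majorant (ι 2 ℚ.* B) k))

  -- Σ_{k<a} Bᵏ / k!
  majorantSum : ℚ → ℕ → ℚ
  majorantSum B zero    = 0ℚ
  majorantSum B (suc a) = majorantSum B a ℚ.+ majorant B a

  0≤majorantSum : ∀ {B} → 0ℚ ≤ B → ∀ a → 0ℚ ≤ majorantSum B a
  0≤majorantSum 0≤B zero    = ℚ.≤-refl
  0≤majorantSum 0≤B (suc a) = ℚ.+-mono-≤ (0≤majorantSum 0≤B a) (0≤majorant 0≤B a)

  -- The terms eventually halve, so the partial sums are Cauchy and hence bounded. They are viewed
  -- in ℚ(i) to reuse the results on Cauchy sequences there.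
  majorantSum-bounded : ∀ {B} → 0ℚ ≤ B → ∃[ C ] (0ℚ < C) × (∀ a → majorantSum B (suc a) ≤ C)
  majorantSum-bounded {B} 0≤B = let C , 0<C , b = cauchy-bounded {S} (cauchy′ {S} step) in
    C , 0<C , λ a → ℚ.≤-trans (a≤∣a∣ (majorantSum B (suc a))) (ℚ.≤-trans (∣re∣≤‖‖ (S a)) (b a))
    where
    S : ℕ → ℚ[i]
    S a = majorantSum B (suc a) +i 0ℚ
    ar = archimedean (ι 2 ℚ.* B)
    open Halving {majorant B} (proj₁ ar) (0≤majorant 0≤B) (majorant-halve 0≤B (proj₁ ar) (proj₂ ar))
      renaming (cauchy to cauchy′)
    step : ∀ k → ‖ S (suc k) -ᵍ S k ‖ ≤ majorant B (suc k)
    step k = ℚ.≤-reflexive (≡.trans (ℚ.+-identityʳ _) (≡.trans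
      (≡.cong ∣_∣ (cancel-left (majorantSum B (suc k)) (majorant B (suc k))))
      (ℚ.0≤p⇒∣p∣≡p (0≤majorant 0≤B (suc k)))))

  module ProductError (B : ℚ) (0≤B : 0ℚ ≤ B) (C : ℚ) (0<C : 0ℚ < C)
    (bound : ∀ a → majorantSum (ι 2 ℚ.* B) (suc a) ≤ C)
    (g h : ℚ[i]) (g≤B : ‖ g ‖ ≤ B) (h≤B : ‖ h ‖ ≤ B) where

    B₂ : ℚ
    B₂ = ι 2 ℚ.* B

    0≤B₂ : 0ℚ ≤ B₂
    0≤B₂ = 0≤* {ι 2} {B} (from-yes (0ℚ ℚ.≤? ι 2)) 0≤B

    ‖expTerm‖-half : ∀ f → ‖ f ‖ ≤ B → ∀ k → ‖ expTerm f k ‖ ≤ half^ k ℚ.* majorant B₂ k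
    ‖expTerm‖-half f f≤B k = ≡.subst (‖ expTerm f k ‖ ≤_) (majorant-half B k) (‖expTerm‖ f f≤B k)

    -- Every term of the tail has degree above b, so its factor 2⁻ᵏ is at most 2⁻ᵇ.
    tail-sum : ∀ a b → ‖ expSum (a ℕ.+ b) h -ᵍ expSum b h ‖ ≤ half^ b ℚ.* majorantSum B₂ (suc (a ℕ.+ b))
    tail-sum zero b = ≡.subst (_≤ half^ b ℚ.* majorantSum B₂ (suc b)) (≡.sym (≡.cong ‖_‖ (g-g (expSum b h))))
      (0≤* (0≤half^ b) (0≤majorantSum 0≤B₂ (suc b)))
    tail-sum (suc a) b = ℚ.≤-trans
      (ℚ.≤-reflexive (≡.cong ‖_‖ (≡.cong₂ _+i_ (add-sub (re E) (re T) (re E₀)) (add-sub (im E) (im T) (im E₀)))))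
      (ℚ.≤-trans (‖+‖ T (E -ᵍ E₀)) (ℚ.≤-trans
        (ℚ.+-mono-≤
          (ℚ.≤-trans (‖expTerm‖-half h h≤B (suc (a ℕ.+ b)))
            (*-monoʳ {m} (0≤majorant 0≤B₂ (suc (a ℕ.+ b))) (half^-antitone (suc a) b)))
          (tail-sum a b))
        (ℚ.≤-reflexive (≡.trans (≡.sym (ℚ.*-distribˡ-+ (half^ b) m M)) (≡.cong (half^ b ℚ.*_) (ℚ.+-comm m M))))))
      where
      E = expSum (a ℕ.+ b) h
      E₀ = expSum b h
      T = expTerm h (suc (a ℕ.+ b))
      m = majorant B₂ (suc (a ℕ.+ b))
      M = majorantSum B₂ (suc (a ℕ.+ b))

    -- Unlike `expSum`, it counts terms and may be empty, which gives `error` its base case.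
    initialSum : ℕ → ℚ[i]
    initialSum zero    = 0ᵍ
    initialSum (suc a) = initialSum a +ᵍ expTerm g a

    initialSum-suc : ∀ N → initialSum (suc N) ≡ expSum N g
    initialSum-suc zero    = ≡.refl
    initialSum-suc (suc N) = ≡.cong (_+ᵍ expTerm g (suc N)) (initialSum-suc N)

    diagonal : ℕ → ℕ → ℚ[i]
    diagonal = antidiagonal (expTerm g) (λ b → expSum b h)

    error-split : ∀ s t e p e₀ → (s +ᵍ t) *ᵍ e -ᵍ (p +ᵍ t *ᵍ e₀) ≡ (s *ᵍ e -ᵍ p) +ᵍ t *ᵍ (e -ᵍ e₀)
    error-split s t e p e₀ = begin
      (s + t) * e + - (p + t * e₀)                  ≡⟨ ≡.cong₂ _+_ (distribʳ e s t) (≡.sym (-‿+-comm p (t * e₀))) ⟩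
      (s * e + t * e) + (- p + - (t * e₀))            ≡⟨ interchange (s * e) (t * e) (- p) (- (t * e₀)) ⟩
      (s * e + - p) + (t * e + - (t * e₀))            ≡⟨ ≡.cong (λ z → (s * e + - p) + (t * e + z)) (-‿distribʳ-* t e₀) ⟩
      (s * e + - p) + (t * e + t * - e₀)              ≡⟨ ≡.cong (λ z → (s * e + - p) + z) (distribˡ t e (- e₀)) ⟨
      (s * e + - p) + t * (e + - e₀)                  ∎
      where
      open Gaussian
      open ≡.≡-Reasoning

    -- Compared with the full product, row i of the triangle misses gⁱ / i! times the tail of the
    -- series of h beyond degree N - i. The two factors decay like 2⁻ⁱ and 2⁻⁽ᴺ⁻ⁱ⁾, so each row
    -- contributes 2⁻ᴺ times a term of a bounded sum.
    error : ∀ a b N → a ℕ.+ b ≡ suc N →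
      ‖ initialSum a *ᵍ expSum N h -ᵍ diagonal a b ‖ ≤ half^ N ℚ.* (C ℚ.* majorantSum B₂ a)
    error zero b N _ = ℚ.≤-reflexive (≡.trans
      (≡.cong (λ z → ‖ z -ᵍ 0ᵍ ‖) (Gaussian.zeroˡ (expSum N h)))
      (≡.sym (≡.trans (≡.cong (half^ N ℚ.*_) (ℚ.*-zeroʳ C)) (ℚ.*-zeroʳ (half^ N)))))
    error (suc a) b N ≡.refl = ℚ.≤-trans
      (ℚ.≤-reflexive (≡.cong ‖_‖ (error-split (initialSum a) T E (diagonal a (suc b)) E₀)))
      (ℚ.≤-trans (‖+‖ (initialSum a *ᵍ E -ᵍ diagonal a (suc b)) (T *ᵍ (E -ᵍ E₀))) (ℚ.≤-trans
        (ℚ.+-mono-≤ (error a (suc b) N (ℕ.+-suc a b))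
          (ℚ.≤-trans (‖*‖ T (E -ᵍ E₀)) (ℚ.≤-trans
            (*-mono-≤ (0≤‖‖ T) (‖expTerm‖-half g g≤B a) (0≤‖‖ (E -ᵍ E₀))
              (ℚ.≤-trans (tail-sum a b) (*-monoˡ {half^ b} (0≤half^ b) (bound (a ℕ.+ b)))))
            (ℚ.≤-reflexive (≡.trans (product-out (half^ a) (majorant B₂ a) (half^ b) C)
              (≡.cong (ℚ._* (C ℚ.* majorant B₂ a)) (≡.sym (half^-+ a b))))))))
        (ℚ.≤-reflexive (factor-out (half^ N) C (majorantSum B₂ a) (majorant B₂ a)))))
      where
      E = expSum (a ℕ.+ b) h
      E₀ = expSum b h
      T = expTerm g a

    product-error : ∀ N → ‖ expSum N g *ᵍ expSum N h -ᵍ expSum N (g +ᵍ h) ‖ ≤ (C ℚ.* C) ℚ.* half^ N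
    product-error N = ≡.subst₂ (λ e p → ‖ e *ᵍ expSum N h -ᵍ p ‖ ≤ (C ℚ.* C) ℚ.* half^ N)
      (initialSum-suc N) (expSum-triangle g h N)
      (ℚ.≤-trans (error (suc N) 0 N (ℕ.+-identityʳ (suc N)))
        (ℚ.≤-trans (*-monoˡ {half^ N} (0≤half^ N) (*-monoˡ {C} (ℚ.<⇒≤ 0<C) (bound N)))
          (ℚ.≤-reflexive (ℚ.*-comm (half^ N) (C ℚ.* C)))))

  -- At stage n the two sides differ by at most C² 2⁻ⁿ, where C depends only on a common bound for
  -- the approximations of x and y.
  exp-+ : ∀ x y → exp x *ᶜ exp y ≈ exp (x +ᶜ y)
  exp-+ x y =
    let Bx , 0<Bx , x≤ = cauchy-bounded (cauchy x)
        By , 0<By , y≤ = cauchy-bounded (cauchy y)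
        B = Bx ℚ.⊔ By
        0≤B = ℚ.≤-trans (ℚ.<⇒≤ 0<Bx) (ℚ.p≤p⊔q Bx By)
        C , 0<C , bound = majorantSum-bounded (0≤* {ι 2} {B} (from-yes (0ℚ ℚ.≤? ι 2)) 0≤B)
        0<C² = ℚ.positive⁻¹ (C ℚ.* C) {{ℚ.pos*pos⇒pos C {{ℚ.positive 0<C}} C {{ℚ.positive 0<C}}}}
    in mk≈ (rescale (C ℚ.* C) 0<C² λ ε 0<ε →
      let N , p = half^-small ε 0<ε in
      N , λ n N≤n → ℚ.≤-trans
        (ProductError.product-error B 0≤B C 0<C bound (seq x n) (seq y n)
          (ℚ.≤-trans (x≤ n) (ℚ.p≤p⊔q Bx By)) (ℚ.≤-trans (y≤ n) (ℚ.p≤q⊔p Bx By)) n)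
        (*-monoˡ {C ℚ.* C} (ℚ.<⇒≤ 0<C²) (p n N≤n)))

  -- Roots of unity

  ½·double : ∀ g → (½ +i 0ℚ) *ᵍ (g +ᵍ g) ≡ g
  ½·double g = begin
    (½ +i 0ℚ) *ᵍ (g +ᵍ g)                 ≡⟨ Gaussian.distribˡ (½ +i 0ℚ) g g ⟩
    (½ +i 0ℚ) *ᵍ g +ᵍ (½ +i 0ℚ) *ᵍ g      ≡⟨ Gaussian.distribʳ g (½ +i 0ℚ) (½ +i 0ℚ) ⟨
    1ᵍ *ᵍ g                               ≡⟨ Gaussian.*-identityˡ g ⟩
    g ∎
    where open ≡.≡-Reasoning

  opaque
    unfolding _⊕_

    ½⊗double : ∀ u → fromℚ ½ ⊗ (u ⊕ u) ≈ u
    ½⊗double u = ≗⇒≈ λ n → ½·double (seq u n)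

  2-torsion-free : ∀ u → u ⊕ u ≈ 0ᶜ → u ≈ 0ᶜ
  2-torsion-free u 2u≈0 = begin
    u                       ≈⟨ ½⊗double u ⟨
    fromℚ ½ ⊗ (u ⊕ u)       ≈⟨ ℂᵣ.*-congˡ 2u≈0 ⟩
    fromℚ ½ ⊗ 0ᶜ            ≈⟨ ℂᵣ.zeroʳ (fromℚ ½) ⟩
    0ᶜ                      ∎
    where open import Relation.Binary.Reasoning.Setoid ℂᵣ.setoid

  -- Conjugation, the value of exp at iπ/2, and half-turns

  conj : ℚ[i] → ℚ[i]
  conj (a +i b) = a +i ℚ.- b

  conj-* : ∀ g h → conj (g *ᵍ h) ≡ conj g *ᵍ conj h
  conj-* (a +i b) (c +i d) = ≡.cong₂ _+i_ (re-conj a b c d) (im-conj a b c d)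
    where
    open +-*-Solver
    re-conj : ∀ a b c d → a ℚ.* c ℚ.- b ℚ.* d ≡ a ℚ.* c ℚ.- (ℚ.- b) ℚ.* (ℚ.- d)
    re-conj = solve 4 (λ a b c d → a :* c :- b :* d := a :* c :- (:- b) :* (:- d)) ≡.refl
    im-conj : ∀ a b c d → ℚ.- (a ℚ.* d ℚ.+ b ℚ.* c) ≡ a ℚ.* (ℚ.- d) ℚ.+ (ℚ.- b) ℚ.* c
    im-conj = solve 4 (λ a b c d → :- (a :* d :+ b :* c) := a :* (:- d) :+ (:- b) :* c) ≡.refl

  expTerm-conj : ∀ g k → expTerm (conj g) k ≡ conj (expTerm g k)
  expTerm-conj g zero    = ≡.refl
  expTerm-conj g (suc k) = ≡.trans
    (≡.cong ((+ 1 / suc k) ·_) (≡.trans (≡.cong (conj g *ᵍ_) (expTerm-conj g k)) (≡.sym (conj-* g (expTerm g k)))))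
    (≡.cong (re (expTerm g (suc k)) +i_) (≡.sym (ℚ.neg-distribʳ-* (+ 1 / suc k) (im (g *ᵍ expTerm g k)))))

  expSum-conj : ∀ g N → expSum N (conj g) ≡ conj (expSum N g)
  expSum-conj g zero    = ≡.refl
  expSum-conj g (suc N) = ≡.trans (≡.cong₂ _+ᵍ_ (expSum-conj g N) (expTerm-conj g (suc N)))
    (≡.cong (re (expSum (suc N) g) +i_) (≡.sym (ℚ.neg-distrib-+ (im (expSum N g)) (im (expTerm g (suc N))))))

  expSum-0 : ∀ N → expSum N 0ᵍ ≡ 1ᵍ
  expSum-0 zero    = ≡.refl
  expSum-0 (suc N) = ≡.trans (≡.cong₂ _+ᵍ_ (expSum-0 N)
    (≡.trans (≡.cong ((+ 1 / suc N) ·_) (Gaussian.zeroˡ (expTerm 0ᵍ N)))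
      (≡.cong₂ _+i_ (ℚ.*-zeroʳ (+ 1 / suc N)) (ℚ.*-zeroʳ (+ 1 / suc N)))))
    (Gaussian.+-identityʳ 1ᵍ)

  exp-inverse : ∀ x → exp x *ᶜ exp (-ᶜ x) ≈ 1ᶜ
  exp-inverse x = ℂᵣ.trans (exp-+ x (-ᶜ x)) (≗⇒≈ λ n →
    ≡.trans (≡.cong (expSum n) (g-g (seq x n))) (expSum-0 n))

  exp-double : ∀ q z → exp (fromℚ q *ᶜ z) *ᶜ exp (fromℚ q *ᶜ z) ≈ exp (fromℚ (q ℚ.+ q) *ᶜ z)
  exp-double q z = ℂᵣ.trans (exp-+ (fromℚ q *ᶜ z) (fromℚ q *ᶜ z)) (≗⇒≈ λ n →
    ≡.cong (expSum n) (≡.sym (Gaussian.distribʳ (seq z n) (q +i 0ℚ) (q +i 0ℚ))))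

  -- Termwise equality rather than `_≈_`, because `cos-½π` speaks about these very approximations.
  IsI½π : ℂ → Set
  IsI½π h = ∀ n → seq h n ≡ iℚ (½πSeq n)

  ½·πi : IsI½π (fromℚ ½ *ᶜ (π *ᶜ 𝕚))
  ½·πi n = ≡.cong₂ _+i_ (re-part (½πSeq n)) (im-part (½πSeq n))
    where
    open +-*-Solver
    re-part : ∀ x → re ((½ +i 0ℚ) *ᵍ (((ι 2 +i 0ℚ) *ᵍ (x +i 0ℚ)) *ᵍ (0ℚ +i 1ℚ))) ≡ 0ℚ
    re-part = solve 1 (λ x →
      let a = con (ι 2) :* x :- con 0ℚ :* con 0ℚ ; b = con (ι 2) :* con 0ℚ :+ con 0ℚ :* x in
      con ½ :* (a :* con 0ℚ :- b :* con 1ℚ) :- con 0ℚ :* (a :* con 1ℚ :+ b :* con 0ℚ) := con 0ℚ) ≡.refl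
    im-part : ∀ x → im ((½ +i 0ℚ) *ᵍ (((ι 2 +i 0ℚ) *ᵍ (x +i 0ℚ)) *ᵍ (0ℚ +i 1ℚ))) ≡ x
    im-part = solve 1 (λ x →
      let a = con (ι 2) :* x :- con 0ℚ :* con 0ℚ ; b = con (ι 2) :* con 0ℚ :+ con 0ℚ :* x in
      con ½ :* (a :* con 1ℚ :+ b :* con 0ℚ) :+ con 0ℚ :* (a :* con 0ℚ :- b :* con 1ℚ) := x) ≡.refl

  -- e^{-iπ/2} is the conjugate of e^{iπ/2}, so the two add up to 2 cos (π/2) = 0.
  exp-neg-i½π : ∀ h → IsI½π h → exp (-ᶜ h) ≈ -ᶜ exp h
  exp-neg-i½π h seq-h = mk≈ (rescale (ι 2) (from-yes (0ℚ ℚ.<? ι 2)) λ ε 0<ε →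
    let N , p = cos-½π ε 0<ε in
    N , λ n N≤n → ℚ.≤-trans (ℚ.≤-reflexive (≡.cong ‖_‖ (difference n)))
      (ℚ.≤-trans (norm (re (E n))) (*-monoˡ {ι 2} (from-yes (0ℚ ℚ.≤? ι 2)) (p n N≤n))))
    where
    E : ℕ → ℚ[i]
    E n = expSum n (iℚ (½πSeq n))
    difference : ∀ n → seq (exp (-ᶜ h)) n -ᵍ seq (-ᶜ exp h) n ≡ (re (E n) ℚ.+ re (E n) +i 0ℚ)
    difference n = ≡.trans
      (≡.cong (λ g → expSum n (-ᵍ g) -ᵍ (-ᵍ expSum n g)) (seq-h n))
      (≡.trans (≡.cong (_-ᵍ (-ᵍ E n)) (expSum-conj (iℚ (½πSeq n)) n))
        (≡.trans (≡.cong (conj (E n) +ᵍ_) (Gaussian.-‿involutive (E n)))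
          (≡.cong (re (E n) ℚ.+ re (E n) +i_) (ℚ.+-inverseˡ (im (E n))))))
    norm : ∀ c → ‖ (c ℚ.+ c) +i 0ℚ ‖ ≤ ι 2 ℚ.* ∣ c ∣
    norm c = ℚ.≤-trans (ℚ.≤-reflexive (ℚ.+-identityʳ ∣ c ℚ.+ c ∣))
      (ℚ.≤-trans (ℚ.∣p+q∣≤∣p∣+∣q∣ c c) (ℚ.≤-reflexive (double ∣ c ∣)))

  square≈-1 : ∀ e e′ → e *ᶜ e′ ≈ 1ᶜ → e′ ≈ -ᶜ e → e ⊗ e ≈ ⊖ 1ᶜ
  square≈-1 e e′ ee′≈1 e′≈-e = begin
    e ⊗ e           ≈⟨ ℂᵣ.-‿involutive (e ⊗ e) ⟨
    ⊖ (⊖ (e ⊗ e))   ≈⟨ ℂᵣ.-‿cong (ℂᵣ.-‿distribʳ-* e e) ⟩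
    ⊖ (e ⊗ (⊖ e))   ≈⟨ ℂᵣ.-‿cong (ℂᵣ.*-congˡ (ℂᵣ.trans e′≈-e (ℂᵣ.sym (⊖≈-ᶜ e)))) ⟨
    ⊖ (e ⊗ e′)      ≈⟨ ℂᵣ.-‿cong (ℂᵣ.trans (⊗≈*ᶜ e e′) ee′≈1) ⟩
    ⊖ 1ᶜ            ∎
    where open import Relation.Binary.Reasoning.Setoid ℂᵣ.setoid

  exp-i½π-square : ∀ h → IsI½π h → exp h ⊗ exp h ≈ ⊖ 1ᶜ
  exp-i½π-square h seq-h = square≈-1 (exp h) (exp (-ᶜ h)) (exp-inverse h) (exp-neg-i½π h seq-h)

  opaque
    -- Opaque for the same reason as the ring operations; `expπi-def` transports facts about `exp`
    -- to it.
    expπi : ℚ → ℂ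
    expπi q = exp (fromℚ q *ᶜ (π *ᶜ 𝕚))

    expπi-def : ∀ q → exp (fromℚ q *ᶜ (π *ᶜ 𝕚)) ≡ expπi q
    expπi-def q = ≡.refl

  expπi-double : ∀ q → expπi q ⊗ expπi q ≈ expπi (q ℚ.+ q)
  expπi-double q = ≡.subst₂ (λ x y → x ⊗ x ≈ y) (expπi-def q) (expπi-def (q ℚ.+ q))
    (ℂᵣ.trans (⊗≈*ᶜ (exp (fromℚ q *ᶜ (π *ᶜ 𝕚))) (exp (fromℚ q *ᶜ (π *ᶜ 𝕚)))) (exp-double q (π *ᶜ 𝕚)))

  expπi-½ : expπi ½ ⊗ expπi ½ ≈ ⊖ 1ᶜ
  expπi-½ = ≡.subst (λ x → x ⊗ x ≈ ⊖ 1ᶜ) (expπi-def ½) (exp-i½π-square (fromℚ ½ *ᶜ (π *ᶜ 𝕚)) ½·πi)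

  2/2n : ∀ n .{{_ : NonZero n}} .{{_ : NonZero (2 ℕ.* n)}} →
    (+ 2 / (2 ℕ.* n)) ℚ.+ (+ 2 / (2 ℕ.* n)) ≡ + 2 / n
  2/2n (suc n) = ℚ.toℚᵘ-injective (ℚᵘ.≃-trans (ℚ.toℚᵘ-homo-+ (+ 2 / d) (+ 2 / d))
    (ℚᵘ.≃-trans (ℚᵘ.+-cong (ℚ.toℚᵘ-fromℚᵘ (+ 2 ℚᵘ./ d)) (ℚ.toℚᵘ-fromℚᵘ (+ 2 ℚᵘ./ d)))
      (ℚᵘ.≃-trans (ℚᵘ.*≡* eq) (ℚᵘ.≃-sym (ℚ.toℚᵘ-fromℚᵘ (+ 2 ℚᵘ./ suc n))))))
    where
    d = 2 ℕ.* suc n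
    nat : ∀ n → (2 ℕ.* (2 ℕ.* n) ℕ.+ 2 ℕ.* (2 ℕ.* n)) ℕ.* n ≡ 2 ℕ.* ((2 ℕ.* n) ℕ.* (2 ℕ.* n))
    nat = solve-∀
    eq : ((+ 2) ℤ.* (+ d) ℤ.+ (+ 2) ℤ.* (+ d)) ℤ.* (+ suc n) ≡ (+ 2) ℤ.* (+ (d ℕ.* d))
    eq = ≡.trans (≡.cong (λ z → (z ℤ.+ z) ℤ.* (+ suc n)) (≡.sym (ℤ.pos-* 2 d)))
      (≡.trans (≡.sym (ℤ.pos-* (2 ℕ.* d ℕ.+ 2 ℕ.* d) (suc n)))
        (≡.trans (≡.cong +_ (nat (suc n))) (ℤ.pos-* 2 (d ℕ.* d))))

  opaque
    unfolding expπi

    root : ∀ n .{{_ : NonZero n}} → ℂ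
    root n = expπi (+ 2 / n)

    root-def : ∀ n .{{_ : NonZero n}} → expπi (+ 2 / n) ≡ root n
    root-def n = ≡.refl

    ω≡root : ∀ n .{{_ : NonZero n}} → ω n ≡ root n
    ω≡root n = ≡.refl

  root-square : ∀ n .{{_ : NonZero n}} .{{_ : NonZero (2 ℕ.* n)}} → root (2 ℕ.* n) ⊗ root (2 ℕ.* n) ≈ root n
  root-square n = ≡.subst₂ (λ x y → x ⊗ x ≈ y) (root-def (2 ℕ.* n))
    (≡.trans (≡.cong expπi (2/2n n)) (root-def n)) (expπi-double (+ 2 / (2 ℕ.* n)))

  -- Each root is the square of the next, so one more squaring reduces k + 1 to k, down to e^(iπ) =
  -- -1.
  root-half-turn : ∀ k .{{_ : NonZero (2 ℕ.^ suc k)}} → root (2 ℕ.^ suc k) ℂᵣ.^ (2 ℕ.^ k) ≈ ⊖ 1ᶜ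
  root-half-turn zero    = ℂᵣ.trans (ℂᵣ.*-identityʳ (root 2))
    -- ½ + ½ and 2/2 both compute to 1, so `root 2` is the square of e^(iπ/2).
    (≡.subst (λ x → x ≈ ⊖ 1ᶜ) (root-def 2) (ℂᵣ.trans (ℂᵣ.sym (expπi-double ½)) expπi-½))
  root-half-turn (suc k) = ℂᵣ.trans (ℂᵣ.sym (ℂᵣ.^-assocʳ (root (2 ℕ.^ suc (suc k))) 2 (2 ℕ.^ k)))
    (ℂᵣ.trans (ℂᵣ.^-congˡ (2 ℕ.^ k)
        (ℂᵣ.trans (ℂᵣ.*-congˡ (ℂᵣ.*-identityʳ (root (2 ℕ.^ suc (suc k))))) (root-square (2 ℕ.^ suc k))))
      (root-half-turn k))
    where instance nonZero = ℕ.m^n≢0 2 (suc k)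

  -- Transfer of powers and sums to the opaque operations

  module Transfer {A : Set} (_~_ : A → A → Set) (_∙_ _∘_ : A → A → A) (ε : A) (~-refl : ∀ {x} → x ~ x)
    (∙~∘ : ∀ {x y u v} → x ~ y → u ~ v → (x ∙ u) ~ (y ∘ v)) where

    ∙-rawMonoid ∘-rawMonoid : RawMonoid 0ℓ 0ℓ
    ∙-rawMonoid = record { Carrier = A ; _≈_ = _~_ ; _∙_ = _∙_ ; ε = ε }
    ∘-rawMonoid = record { Carrier = A ; _≈_ = _~_ ; _∙_ = _∘_ ; ε = ε }

    module ∙ = RawMonoidDefs ∙-rawMonoid
    module ∘ = RawMonoidDefs ∘-rawMonoid

    -- Powers are multiples in the multiplicative monoid, so this covers `_^_`; over an abstract
    -- carrier no complex number gets unfolded.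
    ×-transfer : ∀ n x → (n ∙.× x) ~ (n ∘.× x)
    ×-transfer zero    x = ~-refl
    ×-transfer (suc n) x = ∙~∘ ~-refl (×-transfer n x)

    sum-transfer : ∀ {n} {f g : Vector A n} → (∀ i → f i ~ g i) → ∙.sum f ~ ∘.sum g
    sum-transfer {zero}  f~g = ~-refl
    sum-transfer {suc n} f~g = ∙~∘ (f~g zero) (sum-transfer (λ i → f~g (suc i)))

  *ᶜ≈⊗ : ∀ {x y u v} → x ≈ y → u ≈ v → x *ᶜ u ≈ y ⊗ v
  *ᶜ≈⊗ {x} {y} {u} {v} x≈y u≈v = ℂᵣ.trans (*ᶜ-cong {x} {y} {u} {v} x≈y u≈v) (ℂᵣ.sym (⊗≈*ᶜ y v))

  +ᶜ≈⊕ : ∀ {x y u v} → x ≈ y → u ≈ v → x +ᶜ u ≈ y ⊕ v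
  +ᶜ≈⊕ {x} {y} {u} {v} x≈y u≈v = ℂᵣ.trans (+ᶜ-cong {x} {y} {u} {v} x≈y u≈v) (ℂᵣ.sym (⊕≈+ᶜ y v))

  x-ᶜy≈0⇒x≈y : ∀ x y → x -ᶜ y ≈ 0ᶜ → x ≈ y
  x-ᶜy≈0⇒x≈y x y x-y≈0 = ℂᵣ.x∙y⁻¹≈ε⇒x≈y x y
    (ℂᵣ.trans (ℂᵣ.sym (+ᶜ≈⊕ {x} {x} { -ᶜ y} {⊖ y} ℂᵣ.refl (ℂᵣ.sym (⊖≈-ᶜ y)))) x-y≈0)

  module ^-Transfer = Transfer _≈_ _*ᶜ_ _⊗_ 1ᶜ ℂᵣ.refl *ᶜ≈⊗
  module sum-Transfer = Transfer _≈_ _+ᶜ_ _⊕_ 0ᶜ ℂᵣ.refl +ᶜ≈⊕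

  ^-transfer : ∀ {x y} n → x ≡ y → x Defs.^ n ≈ y ℂᵣ.^ n
  ^-transfer {x} n ≡.refl = ^-Transfer.×-transfer n x

  FT≈root : ∀ n .{{nonZero : NonZero n}} j k →
    FT n {{nonZero}} j k ≈ root n {{nonZero}} ℂᵣ.^ (toℕ j ℕ.* toℕ k)
  FT≈root n {{nonZero}} j k = ^-transfer {ω n {{nonZero}}} (toℕ j ℕ.* toℕ k) (ω≡root n {{nonZero}})

  root-half-turn-≡ : ∀ k n .{{_ : NonZero n}} → n ≡ 2 ℕ.^ suc k → root n ℂᵣ.^ (2 ℕ.^ k) ≈ ⊖ 1ᶜ
  root-half-turn-≡ k n ≡.refl = root-half-turn k

  sum-transfer : ∀ {n} {f g : Vector ℂ n} → (∀ i → f i ≈ g i) → Defs.sum f ≈ ℂᵣ.sum g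
  sum-transfer = sum-Transfer.sum-transfer

-- Blocks of the Fourier matrix

open import Data.Nat.Base using (_*_; _^_; _≤_)
open import Data.Nat.DivMod using (_/_; m*n/n≡m)
open import Data.Rational.Base using () renaming (_≤_ to _≤ℚ_; _/_ to _/ℚ_)
open import Defs using
  ( ℂ; 0ᶜ; 1ᶜ; _≈_; _*ᶜ_; Matrix; _-ᴹ_; LinearlyIndependent; columns; HasRank; FT; IsRigidity )
open ComplexNumbers

blockIndex : ∀ {n} a b → n ≡ a * b → Fin a → Fin b → Fin n
blockIndex a b ≡.refl = combine

toℕ-blockIndex : ∀ {n} a b (n≡ab : n ≡ a * b) i j → toℕ (blockIndex a b n≡ab i j) ≡ b * toℕ i ℕ.+ toℕ j
toℕ-blockIndex a b ≡.refl = Fin.toℕ-combine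

blockIndex-injective : ∀ {n} a b (n≡ab : n ≡ a * b) {i i′ j j′} →
  blockIndex a b n≡ab i j ≡ blockIndex a b n≡ab i′ j′ → i ≡ i′ × j ≡ j′
blockIndex-injective a b ≡.refl {i} {i′} {j} {j′} = Fin.combine-injective i j i′ j′

remQuot-injective : ∀ {a} b {i j : Fin (a * b)} → remQuot {a} b i ≡ remQuot b j → i ≡ j
remQuot-injective {a} b {i} {j} eq = ≡.trans (≡.sym (Fin.combine-remQuot {a} b i))
  (≡.trans (≡.cong (λ (x , y) → combine x y) eq) (Fin.combine-remQuot {a} b j))

-- With ω and `Differs` as parameters, the block argument sees only the half-turn identity and the
-- form of the unchanged entries.
module Blocks (n q s : ℕ) (n≡ : n ≡ q * 2 ^ suc s)
  (ω : ℂ) (half-turn : ω ℂᵣ.^ (q * 2 ^ s) ≈ ⊖ 1ᶜ)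
  (M : Matrix n n) (ρ : ℕ) (rank : HasRank M ρ) (ρ≤r : ρ ≤ 2 ^ s)
  (Differs : Fin n → Fin n → Set) (differs? : ∀ i j → Dec (Differs i j))
  (agree : ∀ i j → ¬ Differs i j → M i j ≈ ω ℂᵣ.^ (toℕ i * toℕ j)) where

  r m : ℕ
  r = 2 ^ s
  m = 2 ^ suc s

  n≡′ : n ≡ m * q
  n≡′ = ≡.trans n≡ (ℕ.*-comm q m)

  row : Fin q → Fin m → Fin n
  row = blockIndex q m n≡

  -- Rows of a block are consecutive, but its columns lie q apart: the ratios of the nodes are then
  -- powers of ω^q, whose 2^s-th power is -1.
  col : Fin q → Fin m → Fin n
  col K u = blockIndex m q n≡′ u K

  Altered : Fin q → Fin q → Fin m → Set
  Altered J K u = ∃[ t ] Differs (row J t) (col K u)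

  altered? : ∀ J K u → Dec (Altered J K u)
  altered? J K u = Fin.any? λ t → differs? (row J t) (col K u)

  1+r≤m : suc r ≤ m
  1+r≤m = ℕ.≤-trans (ℕ.+-monoˡ-≤ r (ℕ.m^n>0 2 s)) (ℕ.≤-reflexive (≡.cong (r ℕ.+_) (≡.sym (ℕ.+-identityʳ r))))

  unaltered-entry : ∀ J K {u} → ¬ Altered J K u → ∀ t →
    M (row J t) (col K u) ≈ ω ℂᵣ.^ ((m * toℕ J ℕ.+ toℕ t) * (q * toℕ u ℕ.+ toℕ K))
  unaltered-entry J K {u} unaltered t = ≡.subst₂ (λ a b → M (row J t) (col K u) ≈ ω ℂᵣ.^ (a * b))
    (toℕ-blockIndex q m n≡ J t) (toℕ-blockIndex m q n≡′ u K)
    (agree (row J t) (col K u) λ differs → unaltered (t , differs))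

  -- N coefficients call for N Vandermonde equations; the rows t < N of the block supply them, as N
  -- ≤ m.
  root-powers-independent : ∀ J (K : Fin q) {N} → N ≤ m → (u : Fin N → Fin m) → Injective _≡_ _≡_ u →
    (v : Vector (Vector ℂ n) N) →
    (∀ l t → v l (row J t) ≈ ω ℂᵣ.^ ((m * toℕ J ℕ.+ toℕ t) * (q * toℕ (u l) ℕ.+ toℕ K))) →
    LinearlyIndependent v
  root-powers-independent J K {N} N≤m u u-injective v v≈ω^ c vanish =
    RootsOfUnity.columns-independent ℂ-commutativeRing
      2-torsion-free ω q s half-turn (toℕ ∘ u) (toℕ K) (m * toℕ J)
      (λ i≢j → i≢j ∘ u-injective ∘ Fin.toℕ-injective) (λ l → Fin.toℕ<n (u l)) c
      λ t t<N → ≡.subst (λ t → ℂᵣ.sum (λ l → c l ⊗ power l t) ≈ 0ᶜ)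
        (Fin.toℕ-fromℕ< (ℕ.<-≤-trans t<N N≤m)) (vanish-row (fromℕ< (ℕ.<-≤-trans t<N N≤m)))
    where
    power : Fin N → ℕ → ℂ
    power l t = ω ℂᵣ.^ ((m * toℕ J ℕ.+ t) * (q * toℕ (u l) ℕ.+ toℕ K))
    vanish-row : ∀ t → ℂᵣ.sum (λ l → c l ⊗ power l (toℕ t)) ≈ 0ᶜ
    vanish-row t = ℂᵣ.trans (ℂᵣ.sym (sum-transfer {f = λ l → c l *ᶜ v l (row J t)}
      λ l → *ᶜ≈⊗ {c l} {c l} {v l (row J t)} {power l (toℕ t)} ℂᵣ.refl (v≈ω^ l t)))
      (vanish (row J t))

  unaltered-independent : ∀ J K {N} → N ≤ m → (u : Fin N → Fin m) → Injective _≡_ _≡_ u →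
    (∀ l → ¬ Altered J K (u l)) → LinearlyIndependent (columns M λ l → col K (u l))
  unaltered-independent J K {N} N≤m u u-injective unaltered = root-powers-independent J K {N} N≤m
    u u-injective (columns M λ l → col K (u l)) (λ l → unaltered-entry J K {u l} (unaltered l))

  altered : ∀ J K → Family (Altered J K) r
  altered J K with pigeonhole (altered? J K) r (suc r)
    -- r + (r + 1) = m + 1, the equality case of `pigeonhole`.
    (ℕ.≤-reflexive (≡.trans (ℕ.+-suc r r) (≡.cong (λ k → suc (r ℕ.+ k)) (≡.sym (ℕ.+-identityʳ r)))))
  ... | inj₁ F = F
  ... | inj₂ F = contradiction
    (proj₂ rank (suc r) (λ l → col K (Family.member F l))
      (unaltered-independent J K 1+r≤m (Family.member F) (Family.injective F) (Family.satisfies F))) (ℕ.<⇒≱ (s≤s ρ≤r))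

  Code : Set
  Code = Fin q × Fin q × Fin r

  position : Code → Fin n × Fin n
  position (J , K , l) = row J (proj₁ (satisfies l)) , col K (member l)
    where open Family (altered J K)

  -- The row determines J, the column determines K and the member u of the family, and u determines
  -- l.
  position-injective : Injective _≡_ _≡_ position
  position-injective {J , K , l} {J′ , K′ , l′} eq
    with ≡.refl , _ ← blockIndex-injective q m n≡ (proj₁ (,-injective eq))
    with u≡u′ , ≡.refl ← blockIndex-injective m q n≡′ (proj₂ (,-injective eq))
    = ≡.cong (λ l → J , K , l) (Family.injective (altered J K) u≡u′)

  position-altered : ∀ x → let i , j = position x in Differs i j
  position-altered (J , K , l) = proj₂ (Family.satisfies (altered J K) l)

  decode : Fin (q * (q * r)) → Code
  decode x = let J , y = remQuot {q} (q * r) x in J , remQuot r y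

  decode-injective : Injective _≡_ _≡_ decode
  decode-injective eq = let J≡ , y≡ = ,-injective eq in
    remQuot-injective {q} (q * r) (≡.cong₂ _,_ J≡ (remQuot-injective {q} r y≡))

  -- There are q² blocks, each with r altered columns, and every such column yields one changed
  -- position.
  weight-bound : q * (q * r) ≤
    length (filter (λ (i , j) → differs? i j) (cartesianProduct (allFin n) (allFin n)))
  weight-bound = injective⇒≤length (decode-injective ∘ position-injective) λ x →
    ∈-filter⁺ (λ (i , j) → differs? i j)
      (∈-cartesianProduct⁺ (∈-allFin (proj₁ (position (decode x)))) (∈-allFin (proj₂ (position (decode x)))))
      (position-altered (decode x))

-- From the count of changed entries to the rational bound

unchanged-entry : ∀ n .{{nonZero : NonZero n}} (M : Matrix n n) i j →
  Dec ((FT n {{nonZero}} -ᴹ M) i j ≈ 0ᶜ) → ¬ ¬ ((FT n {{nonZero}} -ᴹ M) i j ≈ 0ᶜ) →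
  M i j ≈ root n {{nonZero}} ℂᵣ.^ (toℕ i * toℕ j)
unchanged-entry n {{nonZero}} M i j zero? ¬≉0 = ℂᵣ.trans
  -- The zero test that comes with the weight removes the double negation, although `_≈_` is
  -- undecidable in general.
  (ℂᵣ.sym (x-ᶜy≈0⇒x≈y (FT n {{nonZero}} i j) (M i j) (decidable-stable zero? ¬≉0))) (FT≈root n {{nonZero}} i j)

m≤o*n⇒m/n≤o : ∀ a b v .{{_ : NonZero b}} → a ≤ v * b → (+ a) /ℚ b ≤ℚ (+ v) /ℚ 1
m≤o*n⇒m/n≤o a (suc b) v a≤vb = ℚ.toℚᵘ-cancel-≤
  (ℚᵘ.≤-respˡ-≃ (ℚᵘ.≃-sym (ℚ.toℚᵘ-fromℚᵘ (+ a ℚᵘ./ suc b)))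
    (ℚᵘ.≤-respʳ-≃ (ℚᵘ.≃-sym (ℚ.toℚᵘ-fromℚᵘ (+ v ℚᵘ./ 1)))
      (ℚᵘ.*≤* (≡.subst₂ ℤ._≤_ (≡.sym (ℤ.*-identityʳ (+ a))) (ℤ.pos-* v (suc b)) (ℤ.+≤+ a≤vb)))))

-- The left-hand side is (q * (2 * r)) ^ 2, unfolded because solve-∀ does not do so.
square-scale : ∀ q r → (q * (2 * r)) * ((q * (2 * r)) * 1) ≡ (q * (q * r)) * (4 * r)
square-scale = solve-∀

2^-cancel-≤ : ∀ {s k} → 2 ^ s ≤ 2 ^ k → s ≤ k
2^-cancel-≤ {s} {k} 2^s≤2^k with s ℕ.≤? k
... | yes s≤k = s≤k
... | no s≰k =
  contradiction 2^s≤2^k (ℕ.<⇒≱ (ℕ.^-monoʳ-< 2 (s≤s (s≤s z≤n)) (ℕ.≰⇒> s≰k)))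

2^s≤2^[1+k]/2⇒s≤k : ∀ {s k} → 2 ^ s ≤ 2 ^ suc k / 2 → s ≤ k
2^s≤2^[1+k]/2⇒s≤k {s} {k} 2^s≤ = 2^-cancel-≤ (ℕ.≤-trans 2^s≤
  (ℕ.≤-reflexive (≡.trans (≡.cong (_/ 2) (ℕ.*-comm 2 (2 ^ k))) (m*n/n≡m (2 ^ k) 2))))

mainTheorem2 : ∀ (k n : ℕ) .{{_ : NonZero n}} → 1 ≤ k → n ≡ 2 ^ k →
    ∀ (s r : ℕ) .{{_ : NonZero r}} → r ≡ 2 ^ s → r ≤ n / 2 →
    ∀ (v : ℕ) → IsRigidity (FT n) r v →
    _/ℚ_ (+ (n ^ 2)) (4 * r) {{m*n≢0 4 r}} ≤ℚ (+ v) /ℚ 1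
mainTheorem2 (suc k) n {{nonZero}} (s≤s _) n≡2^k s r ≡.refl r≤n/2 v
  ((M , (ρ , rank , ρ≤r) , zero? , weight≡v) , _) =
  m≤o*n⇒m/n≤o (n ^ 2) (4 * r) v {{m*n≢0 4 r}} (≡.subst (_≤ v * (4 * r))
    (≡.sym (≡.trans (≡.cong (_^ 2) n≡qm) (square-scale q r)))
    (ℕ.*-monoˡ-≤ (4 * r) (≡.subst (q * (q * r) ≤_) weight≡v
      (Blocks.weight-bound n q s n≡qm (root n {{nonZero}}) half-turn
        M ρ rank ρ≤r (λ i j → ¬ ((FT n {{nonZero}} -ᴹ M) i j ≈ 0ᶜ)) (λ i j → ¬? (zero? i j))
        (λ i j → unchanged-entry n {{nonZero}} M i j (zero? i j))))))
  where
  q : ℕ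
  -- After matching on `suc k`, n is 2^(k+1), so n / (2r) = 2^(k-s) blocks fit along each side.
  q = 2 ^ (k ℕ.∸ s)
  s≤k : s ≤ k
  s≤k = 2^s≤2^[1+k]/2⇒s≤k (≡.subst (λ n → r ≤ n / 2) n≡2^k r≤n/2)
  2^k≡qr : 2 ^ k ≡ q * 2 ^ s
  2^k≡qr = ≡.trans (≡.cong (2 ^_) (≡.sym (ℕ.m∸n+n≡m s≤k))) (ℕ.^-distribˡ-+-* 2 (k ℕ.∸ s) s)
  swap : ∀ q r → 2 * (q * r) ≡ q * (2 * r)
  swap = solve-∀
  n≡qm : n ≡ q * 2 ^ suc s
  n≡qm = ≡.trans n≡2^k (≡.trans (≡.cong (2 *_) 2^k≡qr) (swap q (2 ^ s)))
  half-turn : root n {{nonZero}} ℂᵣ.^ (q * 2 ^ s) ≈ ⊖ 1ᶜ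
  half-turn = ≡.subst (λ h → root n ℂᵣ.^ h ≈ ⊖ 1ᶜ) 2^k≡qr (root-half-turn-≡ k n n≡2^k)
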